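{- Let $\kappa$ be a finite field, let $n,r$ be positive integers, and for $1\le i\le r$ let $F_i\in\kappa(x_1,\dots,x_n)$ and let $\chi_i:\kappa^\times\to\mathbb{C}^\times$ be a multiplicative character. For $x^{(1)},\dots,x^{(r)}\in\kappa^n$ put \[S(x^{(1)},\dots,x^{(r)}):=\sum_{m\in\kappa^n}\prod_{i=1}^r\chi_i(F_i(m+x^{(i)})).\] Then for every $s\in\mathbb{N}$, \[\sum_{x^{(1)},\dots,x^{(r)}\in\kappa^n}|S(x^{(1)},\dots,x^{(r)})|^{2s}=\sum_{m^{(1)},\dots,m^{(2s)}\in\kappa^n}\ \prod_{i=1}^rT_i(m^{(1)},\dots,m^{(2s)}),\] where \[T_i(m^{(1)},\dots,m^{(2s)}):=\sum_{x\in\kappa^n}\prod_{j=1}^s\chi_i(F_i(m^{(j)}+x))\prod_{j=s+1}^{2s}\chi_i^{ -1}(F_i(m^{(j)}+x))=\sum_{x\in\kappa^n}\chi_i(F_{i,\mathbf{m}}(x))\] and $F_{i,\mathbf{m}}(x):=\prod_{j=1}^sF_i(m^{(j)}+x)\prod_{j=s+1}^{2s}F_i(m^{(j)}+x)^{ -1}$.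
   Context: Multiplicative characters $\chi$ (including $\chi^{ -1}$) are extended to $\kappa$ by $\chi(0)=0$. A rational function $F$ is thought of as a quotient $G/H$ of two fixed polynomials, and $\chi(F(x))$ is stipulated to be $0$ where $G(x)=0$ or $H(x)=0$. In $F_{i,\mathbf{m}}$, the numerator and denominator are the corresponding products of the fixed numerators and denominators of the factors (no cancellation is performed). Convention $0^0=1$. -}

module Defs where

import Algebra.Consequences.Setoid
import Algebra.Properties.AbelianGroup
import Algebra.Properties.CommutativeMonoid.Sum
import Algebra.Properties.Group
import Algebra.Properties.Ring
import Algebra.Properties.Semiring.Exp
open import Algebra.Bundles using (AbelianGroup; CommutativeRing)
open import Algebra.Definitions using (Invertible)
open import Algebra.Morphism.Structures using (IsGroupHomomorphism)
open import Algebra.Structures using (IsCommutativeRing)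
open import Data.Fin as Fin using (Fin; _↑ˡ_; _↑ʳ_)
open import Data.Integer as ℤ using (ℤ; +_)
import Data.Integer.Properties as ℤ
import Data.Integer.Solver as ℤ
open import Data.List using (List; []; _∷_; foldr; map)
open import Data.Nat as ℕ using (ℕ; zero; suc)
import Data.Nat.Properties as ℕ
open import Data.Product using (Σ; ∃; _×_; _,_; proj₁; proj₂)
import Data.Rational
open import Data.Rational as ℚ using (ℚ; 0ℚ; 1ℚ; ½)
import Data.Rational.Properties as ℚ
open import Data.Rational.Solver using (module +-*-Solver)
open import Data.Rational.Unnormalised as ℚᵘ using (mkℚᵘ)
import Data.Rational.Unnormalised.Properties as ℚᵘ
open import Data.Sum using (_⊎_; inj₁; inj₂; map₁)
open import Data.Vec using (Vec; []; _∷_; lookup; zipWith)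
import Data.Vec.Functional as Functional
open import Function using (Inverse; _∘_)
open import Function.Properties.Inverse using (Inverse⇒Injection)
import Function.Construct.Symmetry as Symmetry
open import Level using (Level; _⊔_; 0ℓ)
open import Relation.Binary using (Decidable; IsEquivalence; Setoid)
open import Relation.Binary.PropositionalEquality as ≡ using (_≡_; refl)
open import Relation.Nullary using (¬_; Dec; yes; no; contradiction)
open import Relation.Nullary.Decidable using (via-injection)

module RationalEstimates where
  open Data.Rational
  open +-*-Solver using (solve; _:=_; _:+_; _:*_; _:-_; :-_; con)

  half-pos : ∀ {ε} → 0ℚ < ε → 0ℚ < ½ * ε
  half-pos {ε} 0<ε = ℚ.positive⁻¹ (½ * ε) {{ℚ.pos*pos⇒pos ½ ε {{positive 0<ε}}}}

  half+half : ∀ ε → ½ * ε + ½ * ε ≡ ε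
  half+half = solve 1 (λ e → con ½ :* e :+ con ½ :* e := e) refl

  module _ {ε : ℚ} where
    triangle : ∀ a b → ∣ a ∣ < ½ * ε → ∣ b ∣ < ½ * ε → ∣ a + b ∣ < ε
    triangle a b a<ε/2 b<ε/2 = begin-strict
      ∣ a + b ∣         ≤⟨ ℚ.∣p+q∣≤∣p∣+∣q∣ a b ⟩
      ∣ a ∣ + ∣ b ∣     <⟨ ℚ.+-mono-< a<ε/2 b<ε/2 ⟩
      ½ * ε + ½ * ε     ≡⟨ half+half ε ⟩
      ε                 ∎
      where open ℚ.≤-Reasoning

    via : ∀ a b c → ∣ a - b ∣ < ½ * ε → ∣ b - c ∣ < ½ * ε → ∣ a - c ∣ < ε
    via a b c p q = ≡.subst (λ d → ∣ d ∣ < ε)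
      (solve 3 (λ a b c → (a :- b) :+ (b :- c) := a :- c) refl a b c)
      (triangle (a - b) (b - c) p q)

    close-+ : ∀ a b c d → ∣ a - c ∣ < ½ * ε → ∣ b - d ∣ < ½ * ε →
              ∣ (a + b) - (c + d) ∣ < ε
    close-+ a b c d p q = ≡.subst (λ e → ∣ e ∣ < ε)
      (solve 4 (λ a b c d → (a :- c) :+ (b :- d) := (a :+ b) :- (c :+ d)) refl a b c d)
      (triangle (a - c) (b - d) p q)

  dist-sym : ∀ a b → ∣ a - b ∣ ≡ ∣ b - a ∣
  dist-sym a b = ≡.trans (≡.sym (ℚ.∣-p∣≡∣p∣ (a - b)))
    (≡.cong ∣_∣ (solve 2 (λ a b → :- (a :- b) := b :- a) refl a b))

  dist-neg : ∀ a b → ∣ - a - - b ∣ ≡ ∣ a - b ∣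
  dist-neg a b = ≡.trans
    (≡.cong ∣_∣ (solve 2 (λ a b → :- a :- (:- b) := :- (a :- b)) refl a b))
    (ℚ.∣-p∣≡∣p∣ (a - b))

  dist-refl : ∀ {ε} a → 0ℚ < ε → ∣ a - a ∣ < ε
  dist-refl a 0<ε rewrite ℚ.+-inverseʳ a = 0<ε

  pos-* : ∀ {a b} → 0ℚ < a → 0ℚ < b → 0ℚ < a * b
  pos-* {a} {b} p q = ℚ.positive⁻¹ (a * b) {{ℚ.pos*pos⇒pos a {{positive p}} b {{positive q}}}}

  <-+ˡ : ∀ a {b} → 0ℚ < b → a < a + b
  <-+ˡ a {b} 0<b = begin-strict
    a       ≡⟨ ℚ.+-identityʳ a ⟨
    a + 0ℚ  <⟨ ℚ.+-monoʳ-< a 0<b ⟩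
    a + b   ∎
    where open ℚ.≤-Reasoning

  <-+ʳ : ∀ b {a} → 0ℚ < a → b < a + b
  <-+ʳ b {a} 0<a = ≡.subst (b <_) (ℚ.+-comm b a) (<-+ˡ b 0<a)

  *-mono-bound : ∀ a b {C δ} → 0ℚ < C → ∣ a ∣ < C → ∣ b ∣ < δ → ∣ a * b ∣ < C * δ
  *-mono-bound a b {C} {δ} 0<C a<C b<δ = begin-strict
    ∣ a * b ∣      ≡⟨ ℚ.∣p*q∣≡∣p∣*∣q∣ a b ⟩
    ∣ a ∣ * ∣ b ∣  ≤⟨ ℚ.*-monoʳ-≤-nonNeg ∣ b ∣ {{ℚ.∣-∣-nonNeg b}} (ℚ.<⇒≤ a<C) ⟩
    C * ∣ b ∣      <⟨ ℚ.*-monoʳ-<-pos C {{positive 0<C}} b<δ ⟩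
    C * δ          ∎
    where open ℚ.≤-Reasoning

  quotient : ∀ {ε C} → 0ℚ < ε → 0ℚ < C → ∃ λ δ → 0ℚ < δ × C * δ ≡ ε
  quotient {ε} {C} 0<ε 0<C = 1/C * ε , pos-* 0<1/C 0<ε , eq
    where
    instance _ = ℚ.pos⇒nonZero C {{positive 0<C}}
    1/C = 1/ C
    0<1/C : 0ℚ < 1/C
    0<1/C = ℚ.positive⁻¹ 1/C {{ℚ.1/pos⇒pos C {{positive 0<C}}}}
    eq : C * (1/C * ε) ≡ ε
    eq = ≡.trans (≡.sym (ℚ.*-assoc C 1/C ε))
      (≡.trans (≡.cong (_* ε) (ℚ.*-inverseʳ C)) (ℚ.*-identityˡ ε))

  close-* : ∀ {ε C δ} a b c d → 0ℚ < C → ∣ a ∣ < C → ∣ d ∣ < C → C * δ ≡ ½ * ε →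
            ∣ a - c ∣ < δ → ∣ b - d ∣ < δ → ∣ a * b - c * d ∣ < ε
  close-* {ε} {C} {δ} a b c d 0<C a<C d<C eq p q = ≡.subst (λ e → ∣ e ∣ < ε)
    (solve 4 (λ a b c d → a :* (b :- d) :+ d :* (a :- c) := a :* b :- c :* d) refl a b c d)
    (triangle (a * (b - d)) (d * (a - c))
      (≡.subst (_ <_) eq (*-mono-bound a (b - d) 0<C a<C q))
      (≡.subst (_ <_) eq (*-mono-bound d (a - c) 0<C d<C p)))

module RationalRoot where
  open Data.Rational
  open RationalEstimates
  open +-*-Solver using (solve; _:=_; _:+_; _:*_; _:-_; :-_; con)

  grid : ℕ → ℕ → ℚ
  grid d k = + k / suc d

  toℚᵘ-grid : ∀ d k → toℚᵘ (grid d k) ℚᵘ.≃ mkℚᵘ (+ k) d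
  toℚᵘ-grid d k = ℚ.toℚᵘ-fromℚᵘ (mkℚᵘ (+ k) d)

  grid-suc : ∀ d k → grid d (suc k) ≡ grid d k + grid d 1
  grid-suc d k = ℚ.toℚᵘ-injective (begin
    toℚᵘ (grid d (suc k))                    ≈⟨ toℚᵘ-grid d (suc k) ⟩
    mkℚᵘ (+ suc k) d                         ≈⟨ ℚᵘ.*≡* (eq (+ k) (+ suc d)) ⟩
    mkℚᵘ (+ k) d ℚᵘ.+ mkℚᵘ (+ 1) d           ≈⟨ ℚᵘ.+-cong (toℚᵘ-grid d k) (toℚᵘ-grid d 1) ⟨
    toℚᵘ (grid d k) ℚᵘ.+ toℚᵘ (grid d 1)     ≈⟨ ℚ.toℚᵘ-homo-+ (grid d k) (grid d 1) ⟨
    toℚᵘ (grid d k + grid d 1)               ∎)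
    where
    open ℚᵘ.≃-Reasoning
    eq : ∀ k d → (+ 1 ℤ.+ k) ℤ.* (d ℤ.* d) ≡ (k ℤ.* d ℤ.+ + 1 ℤ.* d) ℤ.* d
    eq = solve′ 2 (λ k d → (con′ (+ 1) ⊕ k) ⊗ (d ⊗ d) ⊜ (k ⊗ d ⊕ con′ (+ 1) ⊗ d) ⊗ d) refl
      where open ℤ.+-*-Solver renaming (solve to solve′; con to con′; _:+_ to _⊕_; _:*_ to _⊗_; _:=_ to _⊜_)

  0≤grid : ∀ d k → 0ℚ ≤ grid d k
  0≤grid d k = ℚ.nonNegative⁻¹ (grid d k) {{ℚ.normalize-nonNeg k (suc d)}}

  module _ {P : ℕ → Set} (P? : ∀ k → Dec (P k)) where

    largest : ℕ → ℕ
    largest zero = zero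
    largest (suc b) with P? (suc b)
    ... | yes _ = suc b
    ... | no  _ = largest b

    largest-holds : ∀ b → largest b ≡ 0 ⊎ P (largest b)
    largest-holds zero = inj₁ refl
    largest-holds (suc b) with P? (suc b)
    ... | yes h = inj₂ h
    ... | no  _ = largest-holds b

    largest-maximal : ∀ b → ¬ P (suc b) → ¬ P (suc (largest b))
    largest-maximal zero ¬h = ¬h
    largest-maximal (suc b) ¬h with P? (suc b)
    ... | yes _  = ¬h
    ... | no ¬h′ = largest-maximal b ¬h′

  -- If (k/(d+1))² ≤ p then k ≤ (|↥ p| + 1)(d + 1), so the search range loses nothing.
  rootIndex : ℕ → ℚ → ℕ
  rootIndex d p = largest (λ k → grid d k * grid d k ≤? p) (suc ℤ.∣ ↥ p ∣ ℕ.* suc d)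

  -- For p ≥ 0 this is √p rounded down to a multiple of 1/(d+1); it is 0 for p < 0.
  root : ℕ → ℚ → ℚ
  root d p = grid d (rootIndex d p)

  square-mono-≤ : ∀ {a b} → 0ℚ ≤ a → a ≤ b → a * a ≤ b * b
  square-mono-≤ {a} {b} 0≤a a≤b = ℚ.≤-trans
    (ℚ.*-monoʳ-≤-nonNeg a {{nonNegative 0≤a}} a≤b)
    (ℚ.*-monoˡ-≤-nonNeg b {{nonNegative (ℚ.≤-trans 0≤a a≤b)}} a≤b)

  grid-large : ∀ p d → let t = grid d (suc (suc ℤ.∣ ↥ p ∣ ℕ.* suc d)) in p < t * t
  grid-large p@(mkℚ i δ _) d = begin-strict
    p       <⟨ p<t ⟩
    t       ≡⟨ ℚ.*-identityʳ t ⟨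
    t * 1ℚ  ≤⟨ ℚ.*-monoˡ-≤-nonNeg t {{nonNegative (0≤grid d K)}} 1≤t ⟩
    t * t   ∎
    where
    open ℚ.≤-Reasoning
    K = suc (suc ℤ.∣ i ∣ ℕ.* suc d)
    t = grid d K
    below : ∀ q → q ℚᵘ.< mkℚᵘ (+ K) d → q ℚᵘ.< toℚᵘ t
    below q = ℚᵘ.<-respʳ-≃ (ℚᵘ.≃-sym (toℚᵘ-grid d K))
    i≤∣i∣ : ∀ i → i ℤ.≤ + ℤ.∣ i ∣
    i≤∣i∣ (+ _)      = ℤ.≤-refl
    i≤∣i∣ ℤ.-[1+ _ ] = ℤ.-≤+
    p<t : p < t
    p<t = ℚ.toℚᵘ-cancel-< (below (toℚᵘ p) (ℚᵘ.*<* (ℤ.≤-<-trans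
      (ℤ.*-monoʳ-≤-nonNeg (+ suc d) (i≤∣i∣ i))
      (≡.subst₂ ℤ._<_ (ℤ.pos-* ℤ.∣ i ∣ (suc d)) (ℤ.pos-* K (suc δ))
        (ℤ.+<+ (ℕ.<-≤-trans
          (ℕ.s≤s (ℕ.*-monoˡ-≤ (suc d) (ℕ.n≤1+n ℤ.∣ i ∣)))
          (ℕ.m≤m*n K (suc δ))))))))
    1≤t : 1ℚ ≤ t
    1≤t = ℚ.<⇒≤ (ℚ.toℚᵘ-cancel-< (below (toℚᵘ 1ℚ) (ℚᵘ.*<* (≡.subst₂ ℤ._<_
      (ℤ.pos-* 1 (suc d)) (ℤ.pos-* K 1)
      (ℤ.+<+ (ℕ.<-≤-trans (ℕ.s≤s (ℕ.*-monoˡ-≤ (suc d) (ℕ.s≤s (ℕ.z≤n {ℤ.∣ i ∣}))))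
        (ℕ.m≤m*n K 1)))))))

  0≤root : ∀ d p → 0ℚ ≤ root d p
  0≤root d p = 0≤grid d (rootIndex d p)

  root-lower : ∀ d p → root d p ≡ 0ℚ ⊎ root d p * root d p ≤ p
  root-lower d p = map₁ (λ k≡0 → ≡.trans (≡.cong (grid d) k≡0) (ℚ.0/n≡0 (suc d)))
    (largest-holds (λ k → grid d k * grid d k ≤? p) (suc ℤ.∣ ↥ p ∣ ℕ.* suc d))

  root-upper : ∀ d p → p < (root d p + grid d 1) * (root d p + grid d 1)
  root-upper d p = ≡.subst (λ t → p < t * t) (grid-suc d (rootIndex d p)) (ℚ.≰⇒>
    (largest-maximal (λ k → grid d k * grid d k ≤? p) (suc ℤ.∣ ↥ p ∣ ℕ.* suc d)
      (λ t²≤p → ℚ.<-irrefl refl (ℚ.<-≤-trans (grid-large p d) t²≤p))))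

  grid-small : ∀ {ε} → 0ℚ < ε → ∃ λ N → ∀ n → N ℕ.≤ n → grid n 1 ≤ ε
  grid-small {ε@(mkℚ (+ zero) δ _)} 0<ε = contradiction (ℚ.positive {p = ε} 0<ε) λ ()
  grid-small {ε@(mkℚ (+ suc a) δ _)} 0<ε = δ , λ n δ≤n → ℚ.toℚᵘ-cancel-≤
    (ℚᵘ.≤-respˡ-≃ (ℚᵘ.≃-sym (toℚᵘ-grid n 1)) (ℚᵘ.*≤* (≡.subst₂ ℤ._≤_
      (ℤ.pos-* 1 (suc δ)) (ℤ.pos-* (suc a) (suc n))
      (ℤ.+≤+ (ℕ.*-mono-≤ (ℕ.s≤s (ℕ.z≤n {a})) (ℕ.s≤s δ≤n))))))
  grid-small {ε@(mkℚ ℤ.-[1+ _ ] δ _)} 0<ε = contradiction (ℚ.positive {p = ε} 0<ε) λ ()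

  square-cancel-< : ∀ {a b} → 0ℚ ≤ b → a * a < b * b → a < b
  square-cancel-< {a} {b} 0≤b h with a <? b
  ... | yes a<b = a<b
  ... | no  a≮b = contradiction (ℚ.<-≤-trans h (square-mono-≤ 0≤b (ℚ.≮⇒≥ a≮b))) (ℚ.<-irrefl refl)

  difference-< : ∀ {a b c} → a < b + c → a - b < c
  difference-< {a} {b} {c} h = ≡.subst (a - b <_)
    (solve 2 (λ b c → (b :+ c) :- b := c) refl b c) (ℚ.+-monoˡ-< (- b) h)

  sum-< : ∀ {a b c} → a - b < c → a < b + c
  sum-< {a} {b} {c} h = ≡.subst (_< b + c)
    (solve 2 (λ a b → b :+ (a :- b) := a) refl a b) (ℚ.+-monoʳ-< b h)

  a≤∣a∣ : ∀ a → a ≤ ∣ a ∣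
  a≤∣a∣ a with ℚ.≤-total 0ℚ a
  ... | inj₁ 0≤a = ℚ.≤-reflexive (≡.sym (ℚ.0≤p⇒∣p∣≡p 0≤a))
  ... | inj₂ a≤0 = ℚ.≤-trans a≤0 (ℚ.0≤∣p∣ a)

  sum-nonNeg : ∀ {a b} → 0ℚ ≤ a → 0ℚ ≤ b → 0ℚ ≤ a + b
  sum-nonNeg = ℚ.+-mono-≤

  approx-root-mono : ∀ {h p q u v e} → 0ℚ < h → 0ℚ ≤ v → 0ℚ ≤ e → e ≤ h →
    u ≡ 0ℚ ⊎ u * u ≤ p → q < (v + e) * (v + e) → p - q < h * h → u < v + (h + h)
  approx-root-mono {h} {v = v} 0<h 0≤v 0≤e e≤h (inj₁ refl) q<[v+e]² p-q<h² =
    ℚ.<-≤-trans (ℚ.+-mono-< 0<h 0<h)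
      (≡.subst (_≤ v + (h + h)) (ℚ.+-identityˡ (h + h)) (ℚ.+-monoˡ-≤ (h + h) 0≤v))
  approx-root-mono {h} {p} {q} {u} {v} {e} 0<h 0≤v 0≤e e≤h (inj₂ u²≤p) q<[v+e]² p-q<h² =
    square-cancel-< {u} {v + (h + h)} (sum-nonNeg 0≤v 0≤h+h) (begin-strict
      u * u                                           ≤⟨ u²≤p ⟩
      p                                               <⟨ sum-< p-q<h² ⟩
      q + h * h                                       ≤⟨ ℚ.+-monoˡ-≤ (h * h) (ℚ.<⇒≤ q<[v+e]²) ⟩
      (v + e) * (v + e) + h * h                       ≤⟨ ℚ.+-monoˡ-≤ (h * h) (square-mono-≤ (sum-nonNeg 0≤v 0≤e) (ℚ.+-monoʳ-≤ v e≤h)) ⟩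
      (v + h) * (v + h) + h * h                       ≡⟨ ℚ.+-identityʳ _ ⟨
      (v + h) * (v + h) + h * h + 0ℚ                  ≤⟨ ℚ.+-monoʳ-≤ ((v + h) * (v + h) + h * h) 0≤rest ⟩
      (v + h) * (v + h) + h * h + (v + h) * (h + h)   ≡⟨ expand v h ⟩
      (v + (h + h)) * (v + (h + h))                   ∎)
    where
    open ℚ.≤-Reasoning
    expand = solve 2 (λ v h → (v :+ h) :* (v :+ h) :+ h :* h :+ (v :+ h) :* (h :+ h)
                              := (v :+ (h :+ h)) :* (v :+ (h :+ h))) refl
    0≤h+h : 0ℚ ≤ h + h
    0≤h+h = sum-nonNeg (ℚ.<⇒≤ 0<h) (ℚ.<⇒≤ 0<h)
    0≤rest : 0ℚ ≤ (v + h) * (h + h)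
    0≤rest = ℚ.nonNegative⁻¹ _ {{ℚ.nonNeg*nonNeg⇒nonNeg
      (v + h) {{nonNegative (sum-nonNeg 0≤v (ℚ.<⇒≤ 0<h))}}
      (h + h) {{nonNegative 0≤h+h}}}}

  distance-< : ∀ u v {ε} → u < v + ε → v < u + ε → ∣ u - v ∣ < ε
  distance-< u v {ε} u<v+ε v<u+ε with ℚ.∣p∣≡p∨∣p∣≡-p (u - v)
  ... | inj₁ eq = ≡.subst (_< ε) (≡.sym eq) (difference-< u<v+ε)
  ... | inj₂ eq = ≡.subst (_< ε)
    (≡.trans (solve 2 (λ u v → v :- u := :- (u :- v)) refl u v) (≡.sym eq)) (difference-< v<u+ε)

  root-close : ∀ {ε} m n p q → 0ℚ < ε → grid m 1 ≤ ½ * ε → grid n 1 ≤ ½ * ε →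
               ∣ p - q ∣ < (½ * ε) * (½ * ε) → ∣ root m p - root n q ∣ < ε
  root-close {ε} m n p q 0<ε em en h = distance-< (root m p) (root n q)
    (≡.subst (λ e → root m p < root n q + e) (half+half ε)
      (approx-root-mono (half-pos 0<ε) (0≤root n q) (0≤grid n 1) en (root-lower m p) (root-upper n q)
        (ℚ.≤-<-trans (a≤∣a∣ (p - q)) h)))
    (≡.subst (λ e → root n q < root m p + e) (half+half ε)
      (approx-root-mono (half-pos 0<ε) (0≤root m p) (0≤grid m 1) em (root-lower n q) (root-upper m p)
        (ℚ.≤-<-trans (a≤∣a∣ (q - p)) (≡.subst (_< (½ * ε) * (½ * ε)) (dist-sym p q) h))))

module Real where
  open RationalEstimates
  open RationalRoot

  IsCauchy : (ℕ → ℚ) → Set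
  IsCauchy x = ∀ ε → 0ℚ ℚ.< ε →
    ∃ λ N → ∀ m n → N ℕ.≤ m → N ℕ.≤ n → ℚ.∣ x m ℚ.- x n ∣ ℚ.< ε

  -- Cauchy reals: the modulus of convergence is part of the data, and equality is _≈_ below.
  record ℝ : Set where
    no-eta-equality
    field
      seq    : ℕ → ℚ
      cauchy : IsCauchy seq
  open ℝ

  eventually-bounded : ∀ x → ∃ λ C → 0ℚ ℚ.< C × ∃ λ N → ∀ n → N ℕ.≤ n → ℚ.∣ seq x n ∣ ℚ.< C
  eventually-bounded X with cauchy X 1ℚ (ℚ.positive⁻¹ 1ℚ)
  ... | N , p = C , ℚ.≤-<-trans (ℚ.0≤∣p∣ (x N)) (bound N ℕ.≤-refl) , N , bound
    where
    open Data.Rational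
    open +-*-Solver using (solve; _:=_; _:+_; _:-_)
    x = seq X
    C = ∣ x N ∣ + 1ℚ
    bound : ∀ n → N ℕ.≤ n → ∣ x n ∣ < C
    bound n N≤n = begin-strict
      ∣ x n ∣                   ≡⟨ ≡.cong ∣_∣ (solve 2 (λ a b → a := b :+ (a :- b)) refl (x n) (x N)) ⟩
      ∣ x N + (x n - x N) ∣     ≤⟨ ℚ.∣p+q∣≤∣p∣+∣q∣ (x N) (x n - x N) ⟩
      ∣ x N ∣ + ∣ x n - x N ∣   <⟨ ℚ.+-monoʳ-< ∣ x N ∣ (p n N N≤n ℕ.≤-refl) ⟩
      C                         ∎
      where open ℚ.≤-Reasoning

  infix 4 _≈_
  record _≈_ (x y : ℝ) : Set where
    constructor close
    field
      eventually : ∀ ε → 0ℚ ℚ.< ε →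
        ∃ λ N → ∀ n → N ℕ.≤ n → ℚ.∣ seq x n ℚ.- seq y n ∣ ℚ.< ε

  fromℚ : ℚ → ℝ
  seq    (fromℚ q) _ = q
  cauchy (fromℚ q) ε 0<ε = 0 , λ _ _ _ _ → dist-refl q 0<ε

  ⊔-boundˡ : ∀ {M N n} → M ℕ.⊔ N ℕ.≤ n → M ℕ.≤ n
  ⊔-boundˡ = ℕ.≤-trans (ℕ.m≤m⊔n _ _)
  ⊔-boundʳ : ∀ {M N n} → M ℕ.⊔ N ℕ.≤ n → N ℕ.≤ n
  ⊔-boundʳ {M} {N} = ℕ.≤-trans (ℕ.m≤n⊔m M N)

  infix 8 -_
  infixl 7 _*_
  infixl 6 _+_

  _+_ : ℝ → ℝ → ℝ
  seq    (x + y) n = seq x n ℚ.+ seq y n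
  cauchy (x + y) ε 0<ε =
    let (M , p) = cauchy x (½ ℚ.* ε) (half-pos 0<ε)
        (N , q) = cauchy y (½ ℚ.* ε) (half-pos 0<ε)
    in M ℕ.⊔ N , λ m n h k → close-+ (seq x m) (seq y m) (seq x n) (seq y n)
         (p m n (⊔-boundˡ h) (⊔-boundˡ k)) (q m n (⊔-boundʳ {M} h) (⊔-boundʳ {M} k))

  -_ : ℝ → ℝ
  seq    (- x) n = ℚ.- seq x n
  cauchy (- x) ε 0<ε =
    let (N , p) = cauchy x ε 0<ε
    in N , λ m n h k → ≡.subst (ℚ._< ε) (≡.sym (dist-neg (seq x m) (seq x n))) (p m n h k)

  common-bound : ∀ x y → ∃ λ C → 0ℚ ℚ.< C × ∃ λ N → ∀ n → N ℕ.≤ n →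
                 ℚ.∣ seq x n ∣ ℚ.< C × ℚ.∣ seq y n ∣ ℚ.< C
  common-bound x y =
    let (A , 0<A , M , p) = eventually-bounded x
        (B , 0<B , N , q) = eventually-bounded y
    in A ℚ.+ B , ℚ.<-trans 0<A (<-+ˡ A 0<B) , M ℕ.⊔ N , λ n M⊔N≤n →
         ℚ.<-trans (p n (⊔-boundˡ M⊔N≤n)) (<-+ˡ A 0<B) ,
         ℚ.<-trans (q n (⊔-boundʳ {M} M⊔N≤n)) (<-+ʳ B 0<A)

  _*_ : ℝ → ℝ → ℝ
  seq    (x * y) n = seq x n ℚ.* seq y n
  cauchy (x * y) ε 0<ε =
    let (C , 0<C , K , b) = common-bound x y
        (δ , 0<δ , eq) = quotient {½ ℚ.* ε} (half-pos 0<ε) 0<C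
        (M , p) = cauchy x δ 0<δ
        (N , q) = cauchy y δ 0<δ
    in K ℕ.⊔ (M ℕ.⊔ N) , λ m n h k → close-* (seq x m) (seq y m) (seq x n) (seq y n) 0<C
         (proj₁ (b m (⊔-boundˡ h))) (proj₂ (b n (⊔-boundˡ k))) eq
         (p m n (⊔-boundˡ (⊔-boundʳ {K} h)) (⊔-boundˡ (⊔-boundʳ {K} k)))
         (q m n (⊔-boundʳ {M} (⊔-boundʳ {K} h)) (⊔-boundʳ {M} (⊔-boundʳ {K} k)))

  ≈-pointwise : ∀ {x y} → (∀ n → seq x n ≡ seq y n) → x ≈ y
  ≈-pointwise {x} {y} eq = close λ ε 0<ε → 0 , λ n _ →
    ≡.subst (λ z → ℚ.∣ seq x n ℚ.- z ∣ ℚ.< ε) (eq n) (dist-refl (seq x n) 0<ε)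

  ≈-isEquivalence : IsEquivalence _≈_
  ≈-isEquivalence = record
    { refl  = ≈-pointwise λ _ → refl
    ; sym   = λ {x} {y} (close p) → close λ ε 0<ε → let (N , h) = p ε 0<ε in
        N , λ n N≤n → ≡.subst (ℚ._< ε) (dist-sym (seq x n) (seq y n)) (h n N≤n)
    ; trans = λ {x} {y} {z} (close p) (close q) → close λ ε 0<ε →
        let (M , h) = p (½ ℚ.* ε) (half-pos 0<ε)
            (N , k) = q (½ ℚ.* ε) (half-pos 0<ε)
        in M ℕ.⊔ N , λ n l → via (seq x n) (seq y n) (seq z n) (h n (⊔-boundˡ l)) (k n (⊔-boundʳ {M} l))
    }

  +-cong : ∀ {x y u v} → x ≈ y → u ≈ v → x + u ≈ y + v
  +-cong {x} {y} {u} {v} (close p) (close q) = close λ ε 0<ε →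
    let (M , h) = p (½ ℚ.* ε) (half-pos 0<ε)
        (N , k) = q (½ ℚ.* ε) (half-pos 0<ε)
    in M ℕ.⊔ N , λ n l → close-+ (seq x n) (seq u n) (seq y n) (seq v n)
         (h n (⊔-boundˡ l)) (k n (⊔-boundʳ {M} l))

  -‿cong : ∀ {x y} → x ≈ y → - x ≈ - y
  -‿cong {x} {y} (close p) = close λ ε 0<ε → let (N , h) = p ε 0<ε in
    N , λ n l → ≡.subst (ℚ._< ε) (≡.sym (dist-neg (seq x n) (seq y n))) (h n l)

  *-cong : ∀ {x y u v} → x ≈ y → u ≈ v → x * u ≈ y * v
  *-cong {x} {y} {u} {v} (close p) (close q) = close λ ε 0<ε →
    let (C , 0<C , K , b) = common-bound x v
        (δ , 0<δ , eq) = quotient {½ ℚ.* ε} (half-pos 0<ε) 0<C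
        (M , h) = p δ 0<δ
        (N , k) = q δ 0<δ
    in K ℕ.⊔ (M ℕ.⊔ N) , λ n l → close-* (seq x n) (seq u n) (seq y n) (seq v n) 0<C
         (proj₁ (b n (⊔-boundˡ l))) (proj₂ (b n (⊔-boundˡ l))) eq
         (h n (⊔-boundˡ (⊔-boundʳ {K} l))) (k n (⊔-boundʳ {M} (⊔-boundʳ {K} l)))

  ℝ-isCommutativeRing : IsCommutativeRing _≈_ _+_ _*_ -_ (fromℚ 0ℚ) (fromℚ 1ℚ)
  ℝ-isCommutativeRing = record
    { isRing = record
      { +-isAbelianGroup = record
        { isGroup = record
          { isMonoid = record
            { isSemigroup = record
              { isMagma = record { isEquivalence = ≈-isEquivalence ; ∙-cong = +-cong }
              ; assoc = λ x y z → ≈-pointwise λ n → ℚ.+-assoc (seq x n) (seq y n) (seq z n)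
              }
            ; identity = (λ x → ≈-pointwise λ n → ℚ.+-identityˡ (seq x n))
                       , (λ x → ≈-pointwise λ n → ℚ.+-identityʳ (seq x n))
            }
          ; inverse = (λ x → ≈-pointwise λ n → ℚ.+-inverseˡ (seq x n))
                    , (λ x → ≈-pointwise λ n → ℚ.+-inverseʳ (seq x n))
          ; ⁻¹-cong = -‿cong
          }
        ; comm = λ x y → ≈-pointwise λ n → ℚ.+-comm (seq x n) (seq y n)
        }
      ; *-cong = *-cong
      ; *-assoc = λ x y z → ≈-pointwise λ n → ℚ.*-assoc (seq x n) (seq y n) (seq z n)
      ; *-identity = (λ x → ≈-pointwise λ n → ℚ.*-identityˡ (seq x n))
                   , (λ x → ≈-pointwise λ n → ℚ.*-identityʳ (seq x n))
      ; distrib = (λ x y z → ≈-pointwise λ n → ℚ.*-distribˡ-+ (seq x n) (seq y n) (seq z n))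
                , (λ x y z → ≈-pointwise λ n → ℚ.*-distribʳ-+ (seq x n) (seq y n) (seq z n))
      }
    ; *-comm = λ x y → ≈-pointwise λ n → ℚ.*-comm (seq x n) (seq y n)
    }

  ℝ-commutativeRing : CommutativeRing 0ℓ 0ℓ
  ℝ-commutativeRing = record { isCommutativeRing = ℝ-isCommutativeRing }

  infix 9 √_
  -- The square root of max(x, 0).
  √_ : ℝ → ℝ
  seq    (√ x) n = root n (seq x n)
  cauchy (√ x) ε 0<ε =
    let (M , p) = cauchy x ((½ ℚ.* ε) ℚ.* (½ ℚ.* ε)) (pos-* (half-pos 0<ε) (half-pos 0<ε))
        (N , q) = grid-small (half-pos 0<ε)
    in M ℕ.⊔ N , λ m n h k → root-close m n (seq x m) (seq x n) 0<ε
         (q m (⊔-boundʳ {M} h)) (q n (⊔-boundʳ {M} k)) (p m n (⊔-boundˡ h) (⊔-boundˡ k))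

module Complex where
  open Real using (ℝ; √_; ≈-pointwise)
  open ℝ using (seq)
  private module R = CommutativeRing Real.ℝ-commutativeRing
  open Algebra.Properties.Ring R.ring using (-0#≈0#)

  record ℂ : Set where
    no-eta-equality
    field
      re im : ℝ
  open ℂ

  infix 4 _≈_
  record _≈_ (z w : ℂ) : Set where
    constructor _,_
    field
      re-≈ : re z R.≈ re w
      im-≈ : im z R.≈ im w

  infix 8 -_
  infixl 7 _*_
  infixl 6 _+_

  _+_ : ℂ → ℂ → ℂ
  re (z + w) = re z R.+ re w
  im (z + w) = im z R.+ im w

  -_ : ℂ → ℂ
  re (- z) = R.- re z
  im (- z) = R.- im z

  _*_ : ℂ → ℂ → ℂ
  re (z * w) = re z R.* re w R.+ R.- (im z R.* im w)
  im (z * w) = re z R.* im w R.+ im z R.* re w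

  fromReal : ℝ → ℂ
  re (fromReal x) = x
  im (fromReal x) = R.0#

  ∣_∣ : ℂ → ℝ
  ∣ z ∣ = √ (re z R.* re z R.+ im z R.* im z)

  private
    ≈-components : ∀ {z w} → (∀ n → seq (re z) n ≡ seq (re w) n) →
                   (∀ n → seq (im z) n ≡ seq (im w) n) → z ≈ w
    ≈-components p q = ≈-pointwise p , ≈-pointwise q

    open +-*-Solver using (solve; _:=_; _:+_; _:*_; :-_; Polynomial)

    _*ʳᵉ_ _*ⁱᵐ_ : ∀ {n} → Polynomial n × Polynomial n → Polynomial n × Polynomial n → Polynomial n
    (a , b) *ʳᵉ (c , d) = a :* c :+ :- (b :* d)
    (a , b) *ⁱᵐ (c , d) = a :* d :+ b :* c

    _⊠_ : ∀ {n} → Polynomial n × Polynomial n → Polynomial n × Polynomial n → Polynomial n × Polynomial n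
    z ⊠ w = z *ʳᵉ w , z *ⁱᵐ w

    _⊞_ : ∀ {n} → Polynomial n × Polynomial n → Polynomial n × Polynomial n → Polynomial n × Polynomial n
    (a , b) ⊞ (c , d) = a :+ c , b :+ d

    *-assoc : ∀ x y z → (x * y) * z ≈ x * (y * z)
    *-assoc x y z = ≈-components
      (λ n → solve 6 (λ a b c d e f → ((a , b) ⊠ (c , d)) *ʳᵉ (e , f) := (a , b) *ʳᵉ ((c , d) ⊠ (e , f))) refl
        (seq (re x) n) (seq (im x) n) (seq (re y) n) (seq (im y) n) (seq (re z) n) (seq (im z) n))
      (λ n → solve 6 (λ a b c d e f → ((a , b) ⊠ (c , d)) *ⁱᵐ (e , f) := (a , b) *ⁱᵐ ((c , d) ⊠ (e , f))) refl
        (seq (re x) n) (seq (im x) n) (seq (re y) n) (seq (im y) n) (seq (re z) n) (seq (im z) n))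

    *-comm : ∀ x y → x * y ≈ y * x
    *-comm x y = ≈-components
      (λ n → solve 4 (λ a b c d → (a , b) *ʳᵉ (c , d) := (c , d) *ʳᵉ (a , b)) refl
        (seq (re x) n) (seq (im x) n) (seq (re y) n) (seq (im y) n))
      (λ n → solve 4 (λ a b c d → (a , b) *ⁱᵐ (c , d) := (c , d) *ⁱᵐ (a , b)) refl
        (seq (re x) n) (seq (im x) n) (seq (re y) n) (seq (im y) n))

    *-identityˡ : ∀ z → fromReal R.1# * z ≈ z
    *-identityˡ z =
      R.trans (R.+-cong (R.*-identityˡ _) (R.trans (R.-‿cong (R.zeroˡ _)) -0#≈0#)) (R.+-identityʳ _) ,
      R.trans (R.+-cong (R.*-identityˡ _) (R.zeroˡ _)) (R.+-identityʳ _)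

    distribˡ : ∀ x y z → x * (y + z) ≈ x * y + x * z
    distribˡ x y z = ≈-components
      (λ n → solve 6 (λ a b c d e f → (a , b) *ʳᵉ ((c , d) ⊞ (e , f)) := (a , b) *ʳᵉ (c , d) :+ (a , b) *ʳᵉ (e , f)) refl
        (seq (re x) n) (seq (im x) n) (seq (re y) n) (seq (im y) n) (seq (re z) n) (seq (im z) n))
      (λ n → solve 6 (λ a b c d e f → (a , b) *ⁱᵐ ((c , d) ⊞ (e , f)) := (a , b) *ⁱᵐ (c , d) :+ (a , b) *ⁱᵐ (e , f)) refl
        (seq (re x) n) (seq (im x) n) (seq (re y) n) (seq (im y) n) (seq (re z) n) (seq (im z) n))

    ≈-isEquivalence : IsEquivalence _≈_
    ≈-isEquivalence = record
      { refl  = R.refl , R.refl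
      ; sym   = λ (p , q) → R.sym p , R.sym q
      ; trans = λ (p , q) (r , s) → R.trans p r , R.trans q s
      }

    +-cong : ∀ {x y u v} → x ≈ y → u ≈ v → x + u ≈ y + v
    +-cong (p , q) (r , s) = R.+-cong p r , R.+-cong q s

    *-cong : ∀ {x y u v} → x ≈ y → u ≈ v → x * u ≈ y * v
    *-cong (p , q) (r , s) =
      R.+-cong (R.*-cong p r) (R.-‿cong (R.*-cong q s)) , R.+-cong (R.*-cong p s) (R.*-cong q r)

    -‿cong : ∀ {x y} → x ≈ y → - x ≈ - y
    -‿cong (p , q) = R.-‿cong p , R.-‿cong q

    ≈-setoid : Setoid 0ℓ 0ℓ
    ≈-setoid = record { isEquivalence = ≈-isEquivalence }

    open Algebra.Consequences.Setoid ≈-setoid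
      using (comm∧idˡ⇒id; comm∧distrˡ⇒distr)

  ℂ-isCommutativeRing : IsCommutativeRing _≈_ _+_ _*_ -_ (fromReal R.0#) (fromReal R.1#)
  ℂ-isCommutativeRing = record
    { isRing = record
      { +-isAbelianGroup = record
        { isGroup = record
          { isMonoid = record
            { isSemigroup = record
              { isMagma = record { isEquivalence = ≈-isEquivalence ; ∙-cong = +-cong }
              ; assoc = λ x y z → R.+-assoc _ _ _ , R.+-assoc _ _ _
              }
            ; identity = (λ x → R.+-identityˡ _ , R.+-identityˡ _) , (λ x → R.+-identityʳ _ , R.+-identityʳ _)
            }
          ; inverse = (λ x → R.-‿inverseˡ _ , R.-‿inverseˡ _) , (λ x → R.-‿inverseʳ _ , R.-‿inverseʳ _)
          ; ⁻¹-cong = -‿cong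
          }
        ; comm = λ x y → R.+-comm _ _ , R.+-comm _ _
        }
      ; *-cong = *-cong
      ; *-assoc = *-assoc
      ; *-identity = comm∧idˡ⇒id *-comm *-identityˡ
      ; distrib = comm∧distrˡ⇒distr +-cong *-comm distribˡ
      }
    ; *-comm = *-comm
    }

  ℂ-commutativeRing : CommutativeRing 0ℓ 0ℓ
  ℂ-commutativeRing = record { isCommutativeRing = ℂ-isCommutativeRing }

open Real using (ℝ; ℝ-commutativeRing) public
open Complex using (ℂ; fromReal; ∣_∣; ℂ-commutativeRing) public
open CommutativeRing ℂ-commutativeRing using () renaming (_≈_ to _≈ᶜ_; _*_ to _*ᶜ_; 0# to 0ᶜ) public
open Algebra.Properties.Semiring.Exp (CommutativeRing.semiring ℝ-commutativeRing)
  using () renaming (_^_ to _^ᴿ_) public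
open Algebra.Properties.CommutativeMonoid.Sum (CommutativeRing.*-commutativeMonoid ℂ-commutativeRing)
  using () renaming (sum to product) public

module _ {c ℓ} (R : CommutativeRing c ℓ) where
  open CommutativeRing R hiding (refl)

  unitGroup : AbelianGroup (c ⊔ ℓ) ℓ
  unitGroup = record
    { Carrier = Σ Carrier (Invertible _≈_ 1# _*_)
    ; _≈_     = λ u v → proj₁ u ≈ proj₁ v
    ; _∙_     = λ (x , x⁻¹ , x⁻¹x , xx⁻¹) (y , y⁻¹ , y⁻¹y , yy⁻¹) →
                  x * y , x⁻¹ * y⁻¹ , product-inverse x⁻¹x y⁻¹y , product-inverse xx⁻¹ yy⁻¹
    ; ε       = 1# , 1# , *-identityˡ 1# , *-identityˡ 1#
    ; _⁻¹     = λ (x , x⁻¹ , x⁻¹x , xx⁻¹) → x⁻¹ , x , xx⁻¹ , x⁻¹x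
    ; isAbelianGroup = record
      { isGroup = record
        { isMonoid = record
          { isSemigroup = record
            { isMagma = record
              { isEquivalence = record { refl = CommutativeRing.refl R ; sym = sym ; trans = trans }
              ; ∙-cong = *-cong
              }
            ; assoc = λ _ _ _ → *-assoc _ _ _
            }
          ; identity = (λ _ → *-identityˡ _) , (λ _ → *-identityʳ _)
          }
        ; inverse = (λ (_ , _ , x⁻¹x , _) → x⁻¹x) , (λ (_ , _ , _ , xx⁻¹) → xx⁻¹)
        ; ⁻¹-cong = λ {(x , x⁻¹ , x⁻¹x , _)} {(y , y⁻¹ , _ , yy⁻¹)} x≈y → begin
            x⁻¹              ≈⟨ *-identityʳ x⁻¹ ⟨
            x⁻¹ * 1#         ≈⟨ *-congˡ yy⁻¹ ⟨
            x⁻¹ * (y * y⁻¹)  ≈⟨ *-assoc x⁻¹ y y⁻¹ ⟨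
            (x⁻¹ * y) * y⁻¹  ≈⟨ *-congʳ (*-congˡ x≈y) ⟨
            (x⁻¹ * x) * y⁻¹  ≈⟨ *-congʳ x⁻¹x ⟩
            1# * y⁻¹         ≈⟨ *-identityˡ y⁻¹ ⟩
            y⁻¹              ∎
        }
      ; comm = λ _ _ → *-comm _ _
      }
    }
    where
    open import Relation.Binary.Reasoning.Setoid setoid
    product-inverse : ∀ {a b c d} → a * b ≈ 1# → c * d ≈ 1# → (a * c) * (b * d) ≈ 1#
    product-inverse {a} {b} {c} {d} ab cd = begin
      (a * c) * (b * d)  ≈⟨ *-assoc a c (b * d) ⟩
      a * (c * (b * d))  ≈⟨ *-congˡ (*-assoc c b d) ⟨
      a * ((c * b) * d)  ≈⟨ *-congˡ (*-congʳ (*-comm c b)) ⟩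
      a * ((b * c) * d)  ≈⟨ *-congˡ (*-assoc b c d) ⟩
      a * (b * (c * d))  ≈⟨ *-assoc a b (c * d) ⟨
      (a * b) * (c * d)  ≈⟨ *-cong ab cd ⟩
      1# * 1#            ≈⟨ *-identityˡ 1# ⟩
      1#                 ∎

record FiniteField c ℓ : Set (Level.suc (c ⊔ ℓ)) where
  field
    commutativeRing : CommutativeRing c ℓ
  open CommutativeRing commutativeRing public
  field
    0≉1         : ¬ 0# ≈ 1#
    invertible  : ∀ x → ¬ x ≈ 0# → Invertible _≈_ 1# _*_ x
    size        : ℕ
    enumeration : Inverse (≡.setoid (Fin size)) setoid

  element : Fin size → Carrier
  element = Inverse.to enumeration

  _≟_ : Decidable _≈_
  _≟_ = via-injection (Inverse⇒Injection (Symmetry.inverse enumeration)) Fin._≟_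

-- κ[x₁,…,xₙ] is taken as κ[x₂,…,xₙ][x₁], each polynomial being the list of its
-- coefficients with the constant one first; trailing zeros are allowed.
module Polynomial {c ℓ} (R : CommutativeRing c ℓ) where
  open CommutativeRing R

  Poly : ℕ → Set c
  Poly zero    = Carrier
  Poly (suc n) = List (Poly n)

  coefficient : ∀ n → Poly n → Vec ℕ n → Carrier
  coefficient zero    a       []            = a
  coefficient (suc n) []      (k ∷ e)       = 0#
  coefficient (suc n) (a ∷ p) (zero ∷ e)    = coefficient n a e
  coefficient (suc n) (a ∷ p) (suc k ∷ e)   = coefficient (suc n) p (k ∷ e)

  IsZero : ∀ n → Poly n → Set ℓ
  IsZero n p = ∀ e → coefficient n p e ≈ 0#

  eval : ∀ n → Poly n → Vec Carrier n → Carrier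
  eval zero    a []      = a
  eval (suc n) p (x ∷ v) = foldr (λ a rest → eval n a v + x * rest) 0# p

  constant : ∀ n → Carrier → Poly n
  constant zero    a = a
  constant (suc n) a = constant n a ∷ []

  add : ∀ n → Poly n → Poly n → Poly n
  add zero    a       b       = a + b
  add (suc n) []      q       = q
  add (suc n) (a ∷ p) []      = a ∷ p
  add (suc n) (a ∷ p) (b ∷ q) = add n a b ∷ add (suc n) p q

  multiply : ∀ n → Poly n → Poly n → Poly n
  multiply zero    a b = a * b
  multiply (suc n) p q =
    foldr (λ a rest → add (suc n) (map (multiply n a) q) (constant n 0# ∷ rest)) [] p

  -- translate n m G is the polynomial G(m + x) in x.
  translate : ∀ n → Vec Carrier n → Poly n → Poly n
  translate zero    []      a = a
  translate (suc n) (m ∷ v) p =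
    foldr (λ a rest → add (suc n) (translate n v a ∷ [])
                        (multiply (suc n) (constant n m ∷ constant n 1# ∷ []) rest)) [] p

module _ {c ℓ} (κ : FiniteField c ℓ) where
  open FiniteField κ hiding (refl)
  open Polynomial commutativeRing

  -- A numerator and a denominator, without cancellation. The denominator may be the
  -- zero polynomial, so that the reciprocal of a fraction with zero numerator makes sense.
  record Fraction (n : ℕ) : Set c where
    constructor _/_
    field
      numerator   : Poly n
      denominator : Poly n
  open Fraction

  record RationalFunction (n : ℕ) : Set (c ⊔ ℓ) where
    field
      fraction      : Fraction n
      denominator≢0 : ¬ IsZero n (denominator fraction)

  _·_ : ∀ {n} → Fraction n → Fraction n → Fraction n
  _·_ {n} (G / H) (G′ / H′) = multiply n G G′ / multiply n H H′

  oneFraction : ∀ {n} → Fraction n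
  oneFraction {n} = constant n 1# / constant n 1#

  reciprocal : ∀ {n} → Fraction n → Fraction n
  reciprocal (G / H) = H / G

  translateFraction : ∀ {n} → Vec Carrier n → Fraction n → Fraction n
  translateFraction {n} m (G / H) = translate n m G / translate n m H

  productFraction : ∀ {n k} → (Fin k → Fraction n) → Fraction n
  productFraction = Functional.foldr _·_ oneFraction

  private
    module κˣ = AbelianGroup (unitGroup commutativeRing)
    module ℂˣ = AbelianGroup (unitGroup ℂ-commutativeRing)

  record MultiplicativeCharacter : Set (c ⊔ ℓ) where
    field
      ⟦_⟧                 : κˣ.Carrier → ℂˣ.Carrier
      isGroupHomomorphism : IsGroupHomomorphism κˣ.rawGroup ℂˣ.rawGroup ⟦_⟧

  open MultiplicativeCharacter

  inverseCharacter : MultiplicativeCharacter → MultiplicativeCharacter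
  inverseCharacter χ = record
    { ⟦_⟧ = λ u → ⟦ χ ⟧ u ℂˣ.⁻¹
    ; isGroupHomomorphism = record
      { isMonoidHomomorphism = record
        { isMagmaHomomorphism = record
          { isRelHomomorphism = record
            { cong = λ {u} {v} u≈v → ℂˣ.⁻¹-cong {⟦ χ ⟧ u} {⟦ χ ⟧ v} (χ.⟦⟧-cong {u} {v} u≈v) }
          ; homo = λ u v → ℂˣ.trans
              {⟦ χ ⟧ (u κˣ.∙ v) ℂˣ.⁻¹} {(⟦ χ ⟧ u ℂˣ.∙ ⟦ χ ⟧ v) ℂˣ.⁻¹} {⟦ χ ⟧ u ℂˣ.⁻¹ ℂˣ.∙ ⟦ χ ⟧ v ℂˣ.⁻¹}
              (ℂˣ.⁻¹-cong {⟦ χ ⟧ (u κˣ.∙ v)} {⟦ χ ⟧ u ℂˣ.∙ ⟦ χ ⟧ v} (χ.homo u v))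
              (ℂˣ.sym {⟦ χ ⟧ u ℂˣ.⁻¹ ℂˣ.∙ ⟦ χ ⟧ v ℂˣ.⁻¹} {(⟦ χ ⟧ u ℂˣ.∙ ⟦ χ ⟧ v) ℂˣ.⁻¹}
                (⁻¹-∙-comm (⟦ χ ⟧ u) (⟦ χ ⟧ v)))
          }
        ; ε-homo = ℂˣ.trans {⟦ χ ⟧ κˣ.ε ℂˣ.⁻¹} {ℂˣ.ε ℂˣ.⁻¹} {ℂˣ.ε}
            (ℂˣ.⁻¹-cong {⟦ χ ⟧ κˣ.ε} {ℂˣ.ε} χ.ε-homo) ε⁻¹≈ε
        }
      ; ⁻¹-homo = λ u → ℂˣ.⁻¹-cong {⟦ χ ⟧ (u κˣ.⁻¹)} {⟦ χ ⟧ u ℂˣ.⁻¹} (χ.⁻¹-homo u)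
      }
    }
    where
    module χ = IsGroupHomomorphism (isGroupHomomorphism χ)
    open Algebra.Properties.AbelianGroup (unitGroup ℂ-commutativeRing) using (⁻¹-∙-comm)
    open Algebra.Properties.Group ℂˣ.group using (ε⁻¹≈ε)

  -- χ(F(x)), which is 0 where the numerator or the denominator of F vanishes.
  evaluate : ∀ {n} → MultiplicativeCharacter → Fraction n → Vec Carrier n → ℂ
  evaluate {n} χ (G / H) x with eval n G x ≟ 0# | eval n H x ≟ 0#
  ... | no G≉0 | no H≉0 = proj₁ (⟦ χ ⟧ ((_ , invertible _ G≉0) κˣ.∙ (_ , invertible _ H≉0) κˣ.⁻¹))
  ... | _      | _      = 0ᶜ

  -- The sum of f over all k-tuples, given summation over single entries.
  sumTuples : ∀ {a b} {A : Set a} {B : Set b} → ((A → B) → B) → ∀ k → (Vec A k → B) → B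
  sumTuples sumA zero    f = f []
  sumTuples sumA (suc k) f = sumA λ a → sumTuples sumA k λ v → f (a ∷ v)

  module _ {c′ ℓ′} (A : CommutativeRing c′ ℓ′) where
    private module A = CommutativeRing A
    open Algebra.Properties.CommutativeMonoid.Sum A.+-commutativeMonoid using (sum)

    sumPoints : ∀ n → (Vec Carrier n → A.Carrier) → A.Carrier
    sumPoints = sumTuples λ f → sum (f ∘ element)

    sumPointTuples : ∀ n k → (Vec (Vec Carrier n) k → A.Carrier) → A.Carrier
    sumPointTuples n = sumTuples (sumPoints n)

  open RationalFunction

  infixl 6 _⊕_
  _⊕_ : ∀ {n} → Vec Carrier n → Vec Carrier n → Vec Carrier n
  _⊕_ = zipWith _+_

  S : ∀ {n r} → (Fin r → RationalFunction n) → (Fin r → MultiplicativeCharacter) →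
      Vec (Vec Carrier n) r → ℂ
  S {n} F χ x = sumPoints ℂ-commutativeRing n λ m → product λ i → evaluate (χ i) (fraction (F i)) (m ⊕ lookup x i)

  -- Of the 2s = s + s points, those with index j ↑ˡ s are the first s and those with
  -- index s ↑ʳ j the last s.
  T : ∀ {n} → RationalFunction n → MultiplicativeCharacter → ∀ s → Vec (Vec Carrier n) (s ℕ.+ s) → ℂ
  T {n} F χ s m = sumPoints ℂ-commutativeRing n λ x →
       product (λ (j : Fin s) → evaluate χ (fraction F) (lookup m (j ↑ˡ s) ⊕ x))
    *ᶜ product (λ (j : Fin s) → evaluate (inverseCharacter χ) (fraction F) (lookup m (s ↑ʳ j) ⊕ x))

  shiftedProduct : ∀ {n} → RationalFunction n → ∀ s → Vec (Vec Carrier n) (s ℕ.+ s) → Fraction n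
  shiftedProduct F s m =
      productFraction (λ (j : Fin s) → translateFraction (lookup m (j ↑ˡ s)) (fraction F))
    · productFraction (λ (j : Fin s) → reciprocal (translateFraction (lookup m (s ↑ʳ j)) (fraction F)))

{-# OPTIONS --safe #-}
-- Since κ^× is finite, z = χ(u) has finite order, so |z|² is a nonnegative real with a power
-- equal to 1; hence |z|² = 1 and χ⁻¹ is the complex conjugate of χ. Therefore |S|²ˢ = Sˢ S̄ˢ is
-- a sum over 2s-tuples of points m. After exchanging it with the sum over x, the summand is a
-- product of functions of the single x⁽ⁱ⁾, so the sum over x is the product of the Tᵢ(m).
-- The two forms of Tᵢ agree termwise because χ, extended by zero, is multiplicative on fractions.
module Submission where

import Algebra.Properties.CommutativeMonoid.Mult
import Algebra.Properties.CommutativeMonoid.Sum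
import Algebra.Properties.CommutativeSemigroup
import Algebra.Properties.Group
import Algebra.Properties.Monoid.Mult
import Algebra.Properties.Ring
import Algebra.Properties.Semiring.Exp
import Algebra.Properties.Semiring.Sum
import Algebra.Solver.Ring.NaturalCoefficients.Default
import Relation.Binary.Reasoning.Setoid as SetoidReasoning
open import Algebra.Bundles using (AbelianGroup; CommutativeMonoid; CommutativeRing; Group; Monoid)
open import Algebra.Morphism.Structures using (IsGroupHomomorphism; IsMonoidHomomorphism)
open import Data.Fin as Fin using (Fin; toℕ; _↑ˡ_; _↑ʳ_)
import Data.Fin.Properties as Fin
open import Data.List using ([]; _∷_; map)
open import Data.Nat as ℕ using (ℕ; zero; suc; NonZero)
import Data.Nat.Properties as ℕ
open import Data.Product using (_×_; _,_; ∃; proj₁; proj₂)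
open import Data.Rational as ℚ using (ℚ; 0ℚ; 1ℚ; ½)
import Data.Rational.Properties as ℚ
open import Data.Sum using (_⊎_; inj₁; inj₂)
open import Data.Vec using (Vec; []; _∷_; lookup; zipWith)
open import Function using (Inverse; _∘_)
open import Level using (Level; _⊔_)
open import Relation.Binary.PropositionalEquality as ≡ using (_≡_)
open import Relation.Nullary using (¬_; yes; no; contradiction)
open import Defs

-- Reals are never compared with each other: the order of two Cauchy reals cannot be decided. Both
-- analytic facts, that the square of `√ x` is `x` and that a nonnegative real with a power equal to
-- 1 is 1, are reduced to inequalities between rational terms of the same index. For the second, a
-- rational q ≥ 0 lies between 1 and q^(k+1), so it is at least as close to 1 as its power is. The
-- value χ(F(x)) is defined by testing two polynomial values for zero and taking chosen inverses. It
-- is therefore first rewritten as a function of two field elements, for which independence of the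
-- chosen inverses, and then multiplicativity, can be proved.

private
  module R = CommutativeRing ℝ-commutativeRing
  module C = CommutativeRing ℂ-commutativeRing

-- Cauchy reals: square roots and nonnegative roots of unity.

module Reals where
  open RationalEstimates
  open RationalRoot
  open Real using (close)
  open ℝ using (seq; cauchy)
  open CommutativeRing ℝ-commutativeRing

  difference-monoˡ : ∀ {a b c} → b ℚ.≤ c → b ℚ.- a ℚ.≤ c ℚ.- a
  difference-monoˡ {a} = ℚ.+-monoˡ-≤ (ℚ.- a)

  0≤difference : ∀ {a b} → a ℚ.≤ b → 0ℚ ℚ.≤ b ℚ.- a
  0≤difference {a} {b} a≤b = ≡.subst (ℚ._≤ b ℚ.- a) (ℚ.+-inverseʳ a) (difference-monoˡ {a} a≤b)

  distance-ordered : ∀ {a b} → a ℚ.≤ b → ℚ.∣ a ℚ.- b ∣ ≡ b ℚ.- a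
  distance-ordered {a} {b} a≤b = ≡.trans (dist-sym a b) (ℚ.0≤p⇒∣p∣≡p (0≤difference a≤b))

  between-distanceˡ : ∀ {a b c} → a ℚ.≤ b → b ℚ.≤ c → ℚ.∣ a ℚ.- b ∣ ℚ.≤ ℚ.∣ a ℚ.- c ∣
  between-distanceˡ {a} a≤b b≤c = ≡.subst₂ ℚ._≤_
    (≡.sym (distance-ordered a≤b)) (≡.sym (distance-ordered (ℚ.≤-trans a≤b b≤c)))
    (difference-monoˡ {a} b≤c)

  between-distanceʳ : ∀ {a b c} → a ℚ.≤ b → b ℚ.≤ c → ℚ.∣ b ℚ.- c ∣ ℚ.≤ ℚ.∣ a ℚ.- c ∣
  between-distanceʳ {a} {b} {c} a≤b b≤c = ≡.subst₂ ℚ._≤_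
    (≡.sym (distance-ordered b≤c)) (≡.sym (distance-ordered (ℚ.≤-trans a≤b b≤c)))
    (ℚ.+-monoʳ-≤ c (ℚ.neg-antimono-≤ a≤b))

  -- The modulus of `u ≈ v` serves unchanged for `x ≈ y`. This is how termwise rational inequalities
  -- become equalities of reals.
  ≈-dominated : ∀ {x y u v} → u ≈ v →
    (∀ n → ℚ.∣ seq x n ℚ.- seq y n ∣ ℚ.≤ ℚ.∣ seq u n ℚ.- seq v n ∣) → x ≈ y
  ≈-dominated {x} {y} {u} {v} (close p) h = close λ ε 0<ε → let (N , q) = p ε 0<ε in
    N , λ n N≤n → ℚ.≤-<-trans
      {ℚ.∣ seq x n ℚ.- seq y n ∣} {ℚ.∣ seq u n ℚ.- seq v n ∣} {ε} (h n) (q n N≤n)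

  -- `grid-small` yields only `≤`, while `IsCauchy` and `_≈_` ask for `<`; applying it to half of
  -- `ε` closes the gap.
  half< : ∀ {ε} → 0ℚ ℚ.< ε → ½ ℚ.* ε ℚ.< ε
  half< {ε} 0<ε = ≡.subst (½ ℚ.* ε ℚ.<_) (half+half ε) (<-+ˡ (½ ℚ.* ε) (half-pos 0<ε))

  -- The rounding error 1/(n+1) of `root n`, made a real number so that the upper bound of the
  -- squeeze is a ring expression whose limit follows from congruence.
  infinitesimal : ℝ
  seq    infinitesimal n = grid n 1
  cauchy infinitesimal ε 0<ε = let (N , p) = grid-small (half-pos 0<ε) in
    N , λ m n N≤m N≤n → distance-< (grid m 1) (grid n 1)
      (bound (p m N≤m) (0≤grid n 1)) (bound (p n N≤n) (0≤grid m 1))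
    where
    bound : ∀ {a b} → a ℚ.≤ ½ ℚ.* ε → 0ℚ ℚ.≤ b → a ℚ.< b ℚ.+ ε
    bound {a} {b} a≤ε/2 0≤b = begin-strict
      a             ≤⟨ a≤ε/2 ⟩
      ½ ℚ.* ε       <⟨ half< 0<ε ⟩
      ε             ≡⟨ ℚ.+-identityˡ ε ⟨
      0ℚ ℚ.+ ε      ≤⟨ ℚ.+-monoˡ-≤ ε 0≤b ⟩
      b ℚ.+ ε       ∎
      where open ℚ.≤-Reasoning

  infinitesimal≈0 : infinitesimal ≈ 0#
  infinitesimal≈0 = close λ ε 0<ε → let (N , p) = grid-small (half-pos 0<ε) in
    N , λ n N≤n → ≡.subst (ℚ._< ε) (≡.sym (distance-0 (0≤grid n 1)))
      (ℚ.≤-<-trans (p n N≤n) (half< 0<ε))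
    where
    distance-0 : ∀ {a} → 0ℚ ℚ.≤ a → ℚ.∣ a ℚ.- 0ℚ ∣ ≡ a
    distance-0 {a} 0≤a = ≡.trans (dist-sym a 0ℚ)
      (≡.trans (distance-ordered 0≤a) (ℚ.+-identityʳ a))

  -- The terms r and e of y and h are abstracted so that √ is never unfolded.
  squeeze-square : ∀ x y h {r e : ℕ → ℚ} → (∀ n → seq y n ≡ r n) → (∀ n → seq h n ≡ e n) → h ≈ 0# →
    (∀ n → r n ℚ.* r n ℚ.≤ seq x n) → (∀ n → seq x n ℚ.≤ (r n ℚ.+ e n) ℚ.* (r n ℚ.+ e n)) → y * y ≈ x
  squeeze-square x y h {r} {e} y≡r h≡e h≈0 lower upper =
    ≈-dominated {y * y} {x} {y * y} {(y + h) * (y + h)} (sym (*-cong y+h≈y y+h≈y))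
      (λ n → between-distanceˡ {seq y n ℚ.* seq y n} {seq x n}
        (≡.subst (λ a → a ℚ.* a ℚ.≤ seq x n) (≡.sym (y≡r n)) (lower n))
        (≡.subst₂ (λ a b → seq x n ℚ.≤ (a ℚ.+ b) ℚ.* (a ℚ.+ b))
          (≡.sym (y≡r n)) (≡.sym (h≡e n)) (upper n)))
    where
    y+h≈y : y + h ≈ y
    y+h≈y = trans (+-congˡ h≈0) (+-identityʳ y)

  -- Absorbs the alternative of `root-lower` in which the search for the root falls back to zero.
  0∨square≤ : ∀ {a p} → 0ℚ ℚ.≤ p → a ≡ 0ℚ ⊎ a ℚ.* a ℚ.≤ p → a ℚ.* a ℚ.≤ p
  0∨square≤ 0≤p (inj₁ ≡.refl) = 0≤p
  0∨square≤ 0≤p (inj₂ a²≤p) = a²≤p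

  -- (√x)² ≤ x ≤ (√x + 1/(n+1))² termwise, and both bounds have the same limit.
  √-square : ∀ x → (∀ n → 0ℚ ℚ.≤ seq x n) → Real.√ x * Real.√ x ≈ x
  √-square x 0≤x = squeeze-square x (Real.√ x) infinitesimal
    {λ n → root n (seq x n)} {λ n → grid n 1} (λ _ → ≡.refl) (λ _ → ≡.refl) infinitesimal≈0
    (λ n → 0∨square≤ (0≤x n) (root-lower n (seq x n))) (λ n → ℚ.<⇒≤ (root-upper n (seq x n)))

  -- Follows the recursion of `_^ᴿ_`, so that the terms of a real power are the powers of the terms.
  powerℚ : ℚ → ℕ → ℚ
  powerℚ q zero    = 1ℚ
  powerℚ q (suc k) = q ℚ.* powerℚ q k

  seq-power : ∀ y k n → seq (y ^ᴿ k) n ≡ powerℚ (seq y n) k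
  seq-power y zero    n = ≡.refl
  seq-power y (suc k) n = ≡.cong (seq y n ℚ.*_) (seq-power y k n)

  module _ {q : ℚ} (0≤q : 0ℚ ℚ.≤ q) where

    powerℚ-≤1 : q ℚ.≤ 1ℚ → ∀ k → powerℚ q k ℚ.≤ 1ℚ
    powerℚ-≤q : q ℚ.≤ 1ℚ → ∀ k → powerℚ q (suc k) ℚ.≤ q

    powerℚ-≤1 q≤1 zero    = ℚ.≤-refl
    powerℚ-≤1 q≤1 (suc k) = ℚ.≤-trans (powerℚ-≤q q≤1 k) q≤1

    powerℚ-≤q q≤1 k = ≡.subst (powerℚ q (suc k) ℚ.≤_) (ℚ.*-identityʳ q)
      (ℚ.*-monoˡ-≤-nonNeg q {{ℚ.nonNegative 0≤q}} (powerℚ-≤1 q≤1 k))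

    powerℚ-≥1 : 1ℚ ℚ.≤ q → ∀ k → 1ℚ ℚ.≤ powerℚ q k
    powerℚ-≥q : 1ℚ ℚ.≤ q → ∀ k → q ℚ.≤ powerℚ q (suc k)

    powerℚ-≥1 1≤q zero    = ℚ.≤-refl
    powerℚ-≥1 1≤q (suc k) = ℚ.≤-trans 1≤q (powerℚ-≥q 1≤q k)

    powerℚ-≥q 1≤q k = ≡.subst (ℚ._≤ powerℚ q (suc k)) (ℚ.*-identityʳ q)
      (ℚ.*-monoˡ-≤-nonNeg q {{ℚ.nonNegative 0≤q}} (powerℚ-≥1 1≤q k))

    -- If q ≤ 1 then q^(k+1) ≤ q ≤ 1, and if q ≥ 1 then 1 ≤ q ≤ q^(k+1): in both cases q lies
    -- between 1 and its power.
    powerℚ-farther : ∀ k → ℚ.∣ q ℚ.- 1ℚ ∣ ℚ.≤ ℚ.∣ powerℚ q (suc k) ℚ.- 1ℚ ∣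
    powerℚ-farther k with ℚ.≤-total q 1ℚ
    ... | inj₁ q≤1 = between-distanceʳ (powerℚ-≤q q≤1 k) q≤1
    ... | inj₂ 1≤q = ≡.subst₂ ℚ._≤_ (dist-sym 1ℚ q) (dist-sym 1ℚ (powerℚ q (suc k)))
      (between-distanceˡ 1≤q (powerℚ-≥q 1≤q k))

  -- The comparison with 1 is made afresh for each rational term, so it does not matter that terms
  -- of `y` may fall on both sides of 1.
  root-of-unity : ∀ y → (∀ n → 0ℚ ℚ.≤ seq y n) → ∀ k → y ^ᴿ suc k ≈ 1# → y ≈ 1#
  root-of-unity y 0≤y k yᵏ⁺¹≈1 = ≈-dominated {y} {1#} {y ^ᴿ suc k} {1#} yᵏ⁺¹≈1 λ n →
    ≡.subst (λ p → ℚ.∣ seq y n ℚ.- 1ℚ ∣ ℚ.≤ ℚ.∣ p ℚ.- 1ℚ ∣) (≡.sym (seq-power y (suc k) n))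
      (powerℚ-farther (0≤y n) k)

  0≤square : ∀ q → 0ℚ ℚ.≤ q ℚ.* q
  0≤square q with ℚ.≤-total 0ℚ q
  ... | inj₁ 0≤q = ≡.subst (ℚ._≤ q ℚ.* q) (ℚ.*-zeroʳ q)
    (ℚ.*-monoˡ-≤-nonNeg q {{ℚ.nonNegative 0≤q}} 0≤q)
  ... | inj₂ q≤0 = ≡.subst (ℚ._≤ q ℚ.* q) (ℚ.*-zeroʳ q)
    (ℚ.*-monoˡ-≤-nonPos q {{ℚ.nonPositive q≤0}} q≤0)

-- Conjugation and the norm of complex numbers.

open Complex.ℂ using (re; im)

conjugate : ℂ → ℂ
re (conjugate z) = re z
im (conjugate z) = CommutativeRing.-_ ℝ-commutativeRing (im z)

norm² : ℂ → ℝ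
norm² z = re z * re z + im z * im z
  where open CommutativeRing ℝ-commutativeRing

module _ where
  open RationalRoot using (sum-nonNeg)
  open Reals
  open ℝ using (seq)
  open Algebra.Properties.Ring R.ring
    using (-‿distribˡ-*; -‿distribʳ-*; -0#≈0#; -‿involutive; -‿+-comm)

  -- Each term is a sum of two rational squares, so the bound holds at every index and not only in
  -- the limit, as `√-square` and `root-of-unity` demand.
  0≤norm² : ∀ z n → 0ℚ ℚ.≤ seq (norm² z) n
  0≤norm² z n = sum-nonNeg (0≤square (seq (re z) n)) (0≤square (seq (im z) n))

  z*conjugate-z : ∀ z → z C.* conjugate z C.≈ fromReal (norm² z)
  z*conjugate-z z =
    R.+-congˡ (R.trans (R.-‿cong (R.sym (-‿distribʳ-* (im z) (im z)))) (-‿involutive _)) Complex.,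
    R.trans (R.+-cong (R.sym (-‿distribʳ-* (re z) (im z))) (R.*-comm (im z) (re z))) (R.-‿inverseˡ _)

  ∣z∣²≈norm² : ∀ z → ∣ z ∣ ^ᴿ 2 R.≈ norm² z
  ∣z∣²≈norm² z = R.trans (R.*-congˡ (R.*-identityʳ ∣ z ∣)) (√-square (norm² z) (0≤norm² z))

  fromReal-+-homo : IsMonoidHomomorphism R.+-rawMonoid C.+-rawMonoid fromReal
  fromReal-+-homo = record
    { isMagmaHomomorphism = record
      { isRelHomomorphism = record { cong = λ x≈y → x≈y Complex., R.refl }
      ; homo = λ x y → R.refl Complex., R.sym (R.+-identityˡ R.0#)
      }
    ; ε-homo = C.refl
    }

  fromReal-*-homo : IsMonoidHomomorphism R.*-rawMonoid C.*-rawMonoid fromReal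
  fromReal-*-homo = record
    { isMagmaHomomorphism = record
      { isRelHomomorphism = record { cong = λ x≈y → x≈y Complex., R.refl }
      ; homo = λ x y →
          R.sym (R.trans (R.+-congˡ (R.trans (R.-‿cong (R.zeroˡ R.0#)) -0#≈0#)) (R.+-identityʳ _)) Complex.,
          R.sym (R.trans (R.+-cong (R.zeroʳ x) (R.zeroˡ y)) (R.+-identityˡ R.0#))
      }
    ; ε-homo = C.refl
    }

  conjugate-cong : ∀ {z w} → z C.≈ w → conjugate z C.≈ conjugate w
  conjugate-cong (p Complex., q) = p Complex., R.-‿cong q

  conjugate-+-homo : IsMonoidHomomorphism C.+-rawMonoid C.+-rawMonoid conjugate
  conjugate-+-homo = record
    { isMagmaHomomorphism = record
      { isRelHomomorphism = record { cong = conjugate-cong }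
      ; homo = λ z w → R.refl Complex., R.sym (-‿+-comm (im z) (im w))
      }
    ; ε-homo = R.refl Complex., -0#≈0#
    }

  conjugate-*-homo : IsMonoidHomomorphism C.*-rawMonoid C.*-rawMonoid conjugate
  conjugate-*-homo = record
    { isMagmaHomomorphism = record
      { isRelHomomorphism = record { cong = conjugate-cong }
      ; homo = λ z w →
          R.+-congˡ (R.-‿cong (R.sym (R.trans (R.sym (-‿distribˡ-* (im z) (R.- im w)))
            (R.trans (R.-‿cong (R.sym (-‿distribʳ-* (im z) (im w)))) (-‿involutive _))))) Complex.,
          R.trans (R.sym (-‿+-comm (re z R.* im w) (im z R.* re w)))
            (R.+-cong (-‿distribʳ-* (re z) (im w)) (-‿distribˡ-* (im z) (re w)))
      }
    ; ε-homo = R.refl Complex., -0#≈0#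
    }

-- Powers, finite order, and the modulus of complex roots of unity.

module _ {a ℓ b ℓ′} (M : Monoid a ℓ) (N : Monoid b ℓ′) where
  private
    module M = Monoid M
    module N = Monoid N
  open Algebra.Properties.Monoid.Mult M using () renaming (_×_ to _×ᴹ_)
  open Algebra.Properties.Monoid.Mult N using () renaming (_×_ to _×ᴺ_)

  -- In a multiplicative monoid the multiples are the powers, `_^ᴿ_` included; this moves powers
  -- through `fromReal`, `conjugate` and characters.
  multiple-homo : ∀ {f} → IsMonoidHomomorphism M.rawMonoid N.rawMonoid f →
                  ∀ k x → f (k ×ᴹ x) N.≈ k ×ᴺ f x
  multiple-homo f-homo zero    x = IsMonoidHomomorphism.ε-homo f-homo
  multiple-homo f-homo (suc k) x =
    N.trans (IsMonoidHomomorphism.homo f-homo _ _) (N.∙-congˡ (multiple-homo f-homo k x))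

module _ {a ℓ} (G : Group a ℓ) where
  open Group G
  open Algebra.Properties.Group G using (identityʳ-unique)
  open Algebra.Properties.Monoid.Mult monoid using (×-homo-+) renaming (_×_ to _⊗_)

  -- Among the `N + 1` powers with exponents 0 to `N` two share an index, and the lower one cancels.
  -- Asking only that `index` separate elements lets units be numbered by their position in the
  -- whole field, without counting the units.
  finite-order : ∀ {N} (index : Carrier → Fin N) → (∀ {x y} → index x ≡ index y → x ≈ y) →
                 ∀ x → ∃ λ d → suc d ⊗ x ≈ ε
  finite-order {N} index injective x
    with i , j , i<j , eq ← Fin.pigeonhole (ℕ.n<1+n N) (λ i → index (toℕ i ⊗ x))
    -- `i < j` means `suc i ≤ j`, so the difference of the exponents appears as `suc d`, visibly
    -- positive.
    with d , i+1+d≡j ← ℕ.m≤n⇒∃[o]m+o≡n i<j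
    = d , identityʳ-unique (toℕ i ⊗ x) (suc d ⊗ x) (begin
      toℕ i ⊗ x ∙ suc d ⊗ x    ≈⟨ ×-homo-+ x (toℕ i) (suc d) ⟨
      (toℕ i ℕ.+ suc d) ⊗ x    ≡⟨ ≡.cong (_⊗ x) (≡.trans (ℕ.+-suc (toℕ i) d) i+1+d≡j) ⟩
      toℕ j ⊗ x                ≈⟨ injective eq ⟨
      toℕ i ⊗ x                ∎)
    where open SetoidReasoning setoid

module _ where
  open Algebra.Properties.Monoid.Mult C.*-monoid using (×-congʳ) renaming (_×_ to _⊗_)

  unitary : ∀ z k → suc k ⊗ z C.≈ C.1# → z C.* conjugate z C.≈ C.1#
  unitary z k zᵏ⁺¹≈1 = C.trans (z*conjugate-z z)
    -- The power equation is derived in ℂ, where `norm² z` splits as z times its conjugate; its real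
    -- part is the equation in ℝ.
    (Reals.root-of-unity (norm² z) (0≤norm² z) k (Complex._≈_.re-≈ fromReal-norm²^) Complex., R.refl)
    where
    open Algebra.Properties.CommutativeMonoid.Mult C.*-commutativeMonoid using (×-distrib-+)
    open SetoidReasoning C.setoid
    fromReal-norm²^ : fromReal (norm² z ^ᴿ suc k) C.≈ C.1#
    fromReal-norm²^ = begin
      fromReal (norm² z ^ᴿ suc k)             ≈⟨ multiple-homo R.*-monoid C.*-monoid fromReal-*-homo (suc k) (norm² z) ⟩
      suc k ⊗ fromReal (norm² z)              ≈⟨ ×-congʳ (suc k) (z*conjugate-z z) ⟨
      suc k ⊗ (z C.* conjugate z)             ≈⟨ ×-distrib-+ z (conjugate z) (suc k) ⟩
      suc k ⊗ z C.* suc k ⊗ conjugate z       ≈⟨ C.*-congˡ (multiple-homo C.*-monoid C.*-monoid conjugate-*-homo (suc k) z) ⟨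
      suc k ⊗ z C.* conjugate (suc k ⊗ z)     ≈⟨ C.*-cong zᵏ⁺¹≈1 (conjugate-cong zᵏ⁺¹≈1) ⟩
      C.1# C.* conjugate C.1#                 ≈⟨ C.*-identityˡ _ ⟩
      conjugate C.1#                          ≈⟨ IsMonoidHomomorphism.ε-homo conjugate-*-homo ⟩
      C.1#                                    ∎

-- Sums over field elements, points and tuples of points.

module _ {a ℓ b ℓ′} (M : CommutativeMonoid a ℓ) (N : CommutativeMonoid b ℓ′) where
  private
    module M = CommutativeMonoid M
    module N = CommutativeMonoid N
  open Algebra.Properties.CommutativeMonoid.Sum M using () renaming (sum to sumᴹ)
  open Algebra.Properties.CommutativeMonoid.Sum N using () renaming (sum to sumᴺ)

  -- Stated for monoids because `product` is the `sum` of a multiplicative monoid: one lemma takes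
  -- conjugation through both the sum and the products in `S`.
  sum-homo : ∀ {φ} → IsMonoidHomomorphism M.rawMonoid N.rawMonoid φ →
             ∀ {k} (f : Fin k → M.Carrier) → φ (sumᴹ f) N.≈ sumᴺ (φ ∘ f)
  sum-homo φ-homo {zero}  f = IsMonoidHomomorphism.ε-homo φ-homo
  sum-homo φ-homo {suc k} f =
    N.trans (IsMonoidHomomorphism.homo φ-homo _ _) (N.∙-congˡ (sum-homo φ-homo (f ∘ Fin.suc)))

module Summation {c ℓ c′ ℓ′} (κ : FiniteField c ℓ) (A : CommutativeRing c′ ℓ′) where
  open CommutativeRing A
  open Algebra.Properties.CommutativeMonoid.Sum +-commutativeMonoid
    using (sum; sum-cong-≋; ∑-distrib-+)
  open Algebra.Properties.CommutativeMonoid.Sum *-commutativeMonoid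
    using () renaming (sum to ∏)

  -- Sums over κ, over points and over tuples of points arise by iterating `sumTuples`. Treating
  -- each as a linear functional on functions lets one induction on the tuple length cover all
  -- levels.
  record IsLinear {i} {I : Set i} (L : (I → Carrier) → Carrier) : Set (i ⊔ c′ ⊔ ℓ′) where
    field
      cong    : ∀ {f g} → (∀ a → f a ≈ g a) → L f ≈ L g
      +-homo  : ∀ f g → L (λ a → f a + g a) ≈ L f + L g
      *-scale : ∀ x f → x * L f ≈ L (λ a → x * f a)

    0-homo : L (λ _ → 0#) ≈ 0#
    0-homo = trans (cong (λ _ → sym (zeroˡ 0#)))
      (trans (sym (*-scale 0# (λ _ → 0#))) (zeroˡ _))

    *-scaleʳ : ∀ f x → L f * x ≈ L (λ a → f a * x)
    *-scaleʳ f x = trans (*-comm _ x) (trans (*-scale x f) (cong (λ _ → *-comm x _)))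

    sum-swap : ∀ {k} (f : I → Fin k → Carrier) →
               L (λ a → sum (f a)) ≈ sum (λ j → L (λ a → f a j))
    sum-swap {zero}  f = 0-homo
    sum-swap {suc k} f = trans (+-homo _ _) (+-congˡ (sum-swap (λ a → f a ∘ Fin.suc)))

  open IsLinear

  sum-linear : ∀ {i} {I : Set i} {k} (e : Fin k → I) → IsLinear (λ f → sum (f ∘ e))
  sum-linear e = record
    { cong    = λ f≈g → sum-cong-≋ (f≈g ∘ e)
    ; +-homo  = λ f g → ∑-distrib-+ (f ∘ e) (g ∘ e)
    ; *-scale = λ x f → *-distribˡ-sum x (f ∘ e)
    }
    where open Algebra.Properties.Semiring.Sum semiring using (*-distribˡ-sum)

  module _ {i} {I : Set i} {L : (I → Carrier) → Carrier} (L-linear : IsLinear L) where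

    tuples-linear : ∀ k → IsLinear (sumTuples κ L k)
    tuples-linear zero = record
      { cong = λ f≈g → f≈g [] ; +-homo = λ _ _ → refl ; *-scale = λ _ _ → refl }
    tuples-linear (suc k) = record
      { cong    = λ f≈g → cong L-linear λ a → cong tail λ v → f≈g (a ∷ v)
      ; +-homo  = λ f g → trans (cong L-linear λ a → +-homo tail _ _) (+-homo L-linear _ _)
      ; *-scale = λ x f → trans (*-scale L-linear x _) (cong L-linear λ a → *-scale tail x _)
      }
      where tail = tuples-linear k

    -- The exchange for a single entry is a hypothesis, so the lemma can be applied to its own
    -- result: from field elements to points, then from points to tuples of points.
    tuples-commute : ∀ {j} {J : Set j} {K : (J → Carrier) → Carrier} →
      (∀ (f : J → I → Carrier) → K (λ b → L (f b)) ≈ L (λ a → K (λ b → f b a))) →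
      ∀ k (f : J → Vec I k → Carrier) → K (λ b → sumTuples κ L k (f b)) ≈ sumTuples κ L k (λ v → K (λ b → f b v))
    tuples-commute         K-L-commute zero    f = refl
    tuples-commute {K = K} K-L-commute (suc k) f = trans (K-L-commute _)
      (cong L-linear λ a → tuples-commute {K = K} K-L-commute k (λ b v → f b (a ∷ v)))

    -- Distributivity: expanding the product selects one summand from each factor, and the
    -- selections form a tuple. Read backwards, it factors a sum whose variables separate.
    product-of-sums : ∀ k (f : Fin k → I → Carrier) →
      ∏ (λ j → L (f j)) ≈ sumTuples κ L k (λ v → ∏ (λ j → f j (lookup v j)))
    product-of-sums zero    f = refl
    product-of-sums (suc k) f = trans (*-congˡ (product-of-sums k (f ∘ Fin.suc)))
      (trans (*-scaleʳ L-linear _ _) (cong L-linear λ a → *-scale (tuples-linear k) _ _))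

    -- Induction on `s` removes the head of the tuple, and under it `↑ˡ` and `↑ʳ` compute, so the
    -- tuple never has to be split in two.
    product-of-sums₂ : ∀ s t (f : Fin s → I → Carrier) (g : Fin t → I → Carrier) →
      ∏ (λ j → L (f j)) * ∏ (λ j → L (g j)) ≈
      sumTuples κ L (s ℕ.+ t) λ v → ∏ (λ j → f j (lookup v (j ↑ˡ t))) * ∏ (λ j → g j (lookup v (s ↑ʳ j)))
    product-of-sums₂ zero    t f g =
      trans (*-congˡ (product-of-sums t g)) (*-scale (tuples-linear t) _ _)
    product-of-sums₂ (suc s) t f g = trans (*-assoc _ _ _)
      (trans (*-congˡ (product-of-sums₂ s t (f ∘ Fin.suc) g))
      (trans (*-scaleʳ L-linear _ _) (cong L-linear λ a →
        trans (*-scale (tuples-linear (s ℕ.+ t)) _ _)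
          (cong (tuples-linear (s ℕ.+ t)) λ v → sym (*-assoc _ _ _)))))

  points-linear : ∀ n → IsLinear (sumPoints κ A n)
  points-linear n = tuples-linear (sum-linear (FiniteField.element κ)) n

  pointTuples-linear : ∀ n k → IsLinear (sumPointTuples κ A n k)
  pointTuples-linear n = tuples-linear (points-linear n)

  linear-commute : ∀ {i} {I : Set i} {L : (I → Carrier) → Carrier} → IsLinear L →
    ∀ n k (f : I → Vec (Vec (FiniteField.Carrier κ) n) k → Carrier) →
    L (λ b → sumPointTuples κ A n k (f b)) ≈ sumPointTuples κ A n k (λ v → L (λ b → f b v))
  linear-commute {L = L} L-linear n = tuples-commute (points-linear n) {K = L}
    (tuples-commute (sum-linear element) {K = L} (λ f → sum-swap L-linear (λ b → f b ∘ element)) n)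
    where open FiniteField κ using (element)

-- Additive maps between rings commute with these sums.

module Transport {c ℓ a ℓ₁ b ℓ₂} (κ : FiniteField c ℓ) (A : CommutativeRing a ℓ₁) (B : CommutativeRing b ℓ₂)
  {φ} (φ-homo : IsMonoidHomomorphism (CommutativeRing.+-rawMonoid A) (CommutativeRing.+-rawMonoid B) φ) where
  private
    module A = CommutativeRing A
    module B = CommutativeRing B
  open Summation κ B

  tuples-homo : ∀ {i} {I : Set i} {L M} → IsLinear M →
    (∀ (f : I → A.Carrier) → φ (L f) B.≈ M (φ ∘ f)) →
    ∀ k f → φ (sumTuples κ L k f) B.≈ sumTuples κ M k (φ ∘ f)
  tuples-homo                 M-linear φ-L zero    f = B.refl
  tuples-homo {L = L} {M = M} M-linear φ-L (suc k) f = B.trans (φ-L _) (IsLinear.cong M-linear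
    λ a → tuples-homo {L = L} {M = M} M-linear φ-L k (λ v → f (a ∷ v)))

  points-homo : ∀ n f → φ (sumPoints κ A n f) B.≈ sumPoints κ B n (φ ∘ f)
  points-homo = tuples-homo (sum-linear (FiniteField.element κ))
    (λ f → sum-homo A.+-commutativeMonoid B.+-commutativeMonoid φ-homo (f ∘ FiniteField.element κ))

  pointTuples-homo : ∀ n k f → φ (sumPointTuples κ A n k f) B.≈ sumPointTuples κ B n k (φ ∘ f)
  pointTuples-homo n = tuples-homo (points-linear n) (points-homo n)

-- Evaluation of sums, products and translates of polynomials.

module Evaluation {c ℓ} (R : CommutativeRing c ℓ) where
  open CommutativeRing R
  open Polynomial R
  open Algebra.Solver.Ring.NaturalCoefficients.Default commutativeSemiring
    using (solve; _:=_; _:+_; _:*_; con)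
  open SetoidReasoning setoid

  eval-add : ∀ n p q v → eval n (add n p q) v ≈ eval n p v + eval n q v
  eval-add zero    p       q       []      = refl
  eval-add (suc n) []      q       (x ∷ v) = sym (+-identityˡ _)
  eval-add (suc n) (a ∷ p) []      (x ∷ v) = sym (+-identityʳ _)
  eval-add (suc n) (a ∷ p) (b ∷ q) (x ∷ v) = begin
    eval n (add n a b) v + x * eval (suc n) (add (suc n) p q) (x ∷ v)
      ≈⟨ +-cong (eval-add n a b v) (*-congˡ (eval-add (suc n) p q (x ∷ v))) ⟩
    (eval n a v + eval n b v) + x * (eval (suc n) p (x ∷ v) + eval (suc n) q (x ∷ v))
      ≈⟨ solve 5 (λ a b x p q → (a :+ b) :+ x :* (p :+ q) := (a :+ x :* p) :+ (b :+ x :* q)) refl _ _ _ _ _ ⟩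
    (eval n a v + x * eval (suc n) p (x ∷ v)) + (eval n b v + x * eval (suc n) q (x ∷ v)) ∎

  eval-constant : ∀ n a v → eval n (constant n a) v ≈ a
  eval-constant zero    a []      = refl
  eval-constant (suc n) a (x ∷ v) =
    trans (+-cong (eval-constant n a v) (zeroʳ x)) (+-identityʳ a)

  -- Mutual with `eval-scale`: multiplying by a coefficient is multiplication in one variable fewer,
  -- so the induction is on the number of variables and then on the list.
  eval-multiply : ∀ n p q v → eval n (multiply n p q) v ≈ eval n p v * eval n q v

  eval-scale : ∀ n a q x v →
    eval (suc n) (map (multiply n a) q) (x ∷ v) ≈ eval n a v * eval (suc n) q (x ∷ v)
  eval-scale n a []      x v = sym (zeroʳ _)
  eval-scale n a (b ∷ q) x v = begin
    eval n (multiply n a b) v + x * eval (suc n) (map (multiply n a) q) (x ∷ v)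
      ≈⟨ +-cong (eval-multiply n a b v) (*-congˡ (eval-scale n a q x v)) ⟩
    eval n a v * eval n b v + x * (eval n a v * eval (suc n) q (x ∷ v))
      ≈⟨ solve 4 (λ a b x q → a :* b :+ x :* (a :* q) := a :* (b :+ x :* q)) refl _ _ _ _ ⟩
    eval n a v * (eval n b v + x * eval (suc n) q (x ∷ v)) ∎

  eval-multiply zero    p       q []      = refl
  eval-multiply (suc n) []      q (x ∷ v) = sym (zeroˡ _)
  eval-multiply (suc n) (a ∷ p) q (x ∷ v) = begin
    eval (suc n) (add (suc n) (map (multiply n a) q) (constant n 0# ∷ multiply (suc n) p q)) (x ∷ v)
      ≈⟨ eval-add (suc n) (map (multiply n a) q) (constant n 0# ∷ multiply (suc n) p q) (x ∷ v) ⟩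
    eval (suc n) (map (multiply n a) q) (x ∷ v) +
      (eval n (constant n 0#) v + x * eval (suc n) (multiply (suc n) p q) (x ∷ v))
      ≈⟨ +-cong (eval-scale n a q x v)
           (+-cong (eval-constant n 0# v) (*-congˡ (eval-multiply (suc n) p q (x ∷ v)))) ⟩
    eval n a v * eval (suc n) q (x ∷ v) +
      (0# + x * (eval (suc n) p (x ∷ v) * eval (suc n) q (x ∷ v)))
      ≈⟨ solve 4 (λ a q x p → a :* q :+ (con 0 :+ x :* (p :* q)) := (a :+ x :* p) :* q) refl _ _ _ _ ⟩
    (eval n a v + x * eval (suc n) p (x ∷ v)) * eval (suc n) q (x ∷ v) ∎

  eval-singleton : ∀ n a x v → eval (suc n) (a ∷ []) (x ∷ v) ≈ eval n a v
  eval-singleton n a x v = trans (+-congˡ (zeroʳ x)) (+-identityʳ (eval n a v))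

  eval-monic-linear : ∀ n y x v → eval (suc n) (constant n y ∷ constant n 1# ∷ []) (x ∷ v) ≈ y + x
  eval-monic-linear n y x v = +-cong (eval-constant n y v)
    (trans (*-congˡ (trans (eval-singleton n (constant n 1#) x v) (eval-constant n 1# v))) (*-identityʳ x))

  -- `translate` is Horner's scheme in the polynomial y + X, and evaluation turns each of its steps
  -- into a Horner step at y + x.
  eval-translate : ∀ n m p v → eval n (translate n m p) v ≈ eval n p (zipWith _+_ m v)
  eval-translate zero    []      p       []      = refl
  eval-translate (suc n) (y ∷ m) []      (x ∷ v) = refl
  eval-translate (suc n) (y ∷ m) (a ∷ p) (x ∷ v) = begin
    eval (suc n) (add (suc n) (translate n m a ∷ []) (multiply (suc n) y+X p′)) (x ∷ v)
      ≈⟨ eval-add (suc n) (translate n m a ∷ []) (multiply (suc n) y+X p′) (x ∷ v) ⟩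
    eval (suc n) (translate n m a ∷ []) (x ∷ v) + eval (suc n) (multiply (suc n) y+X p′) (x ∷ v)
      ≈⟨ +-cong
           (trans (eval-singleton n (translate n m a) x v) (eval-translate n m a v))
           (trans (eval-multiply (suc n) y+X p′ (x ∷ v))
             (*-cong (eval-monic-linear n y x v) (eval-translate (suc n) (y ∷ m) p (x ∷ v)))) ⟩
    eval n a (zipWith _+_ m v) + (y + x) * eval (suc n) p (zipWith _+_ (y ∷ m) (x ∷ v)) ∎
    where
    y+X = constant n y ∷ constant n 1# ∷ []
    p′  = translate (suc n) (y ∷ m) p

-- Characters extended by zero and their values on fractions.

module Characters {c ℓ} (κ : FiniteField c ℓ) where
  open FiniteField κ
  open MultiplicativeCharacter using (⟦_⟧; isGroupHomomorphism)
  private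
    module κ  = FiniteField κ
    module κˣ = AbelianGroup (unitGroup commutativeRing)
    module ℂˣ = AbelianGroup (unitGroup ℂ-commutativeRing)

    Character : Set _
    Character = MultiplicativeCharacter κ

  open Algebra.Properties.Monoid.Mult κˣ.monoid using () renaming (_×_ to _⊗_)
  open Algebra.Properties.Monoid.Mult C.*-monoid using () renaming (_×_ to _⊗ᶜ_)

  value : Character → κˣ.Carrier → ℂ
  value χ u = proj₁ (⟦ χ ⟧ u)

  value-cong : ∀ χ {u v} → u κˣ.≈ v → value χ u C.≈ value χ v
  value-cong χ {u} {v} = IsGroupHomomorphism.⟦⟧-cong (isGroupHomomorphism χ) {u} {v}

  value-homo : ∀ χ → IsMonoidHomomorphism κˣ.rawMonoid C.*-rawMonoid (value χ)
  value-homo χ = record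
    { isMagmaHomomorphism = record
      { isRelHomomorphism = record { cong = λ {u} {v} → value-cong χ {u} {v} }
      ; homo = IsGroupHomomorphism.homo (isGroupHomomorphism χ)
      }
    ; ε-homo = IsGroupHomomorphism.ε-homo (isGroupHomomorphism χ)
    }

  value-inverse : ∀ χ u → value χ (u κˣ.⁻¹) C.≈ value (inverseCharacter κ χ) u
  value-inverse χ = IsGroupHomomorphism.⁻¹-homo (isGroupHomomorphism χ)

  unit-order : ∀ u → ∃ λ d → suc d ⊗ u κˣ.≈ κˣ.ε
  unit-order = finite-order κˣ.group (λ u → from (proj₁ u)) λ {u} {v} eq → begin
    proj₁ u              ≈⟨ strictlyInverseˡ (proj₁ u) ⟨
    to (from (proj₁ u))  ≡⟨ ≡.cong to eq ⟩
    to (from (proj₁ v))  ≈⟨ strictlyInverseˡ (proj₁ v) ⟩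
    proj₁ v              ∎
    where
    open Inverse enumeration using (to; from; strictlyInverseˡ)
    open SetoidReasoning setoid

  -- Both sides are inverse to χ(u) in ℂ, and inverses are unique.
  conjugate-value : ∀ χ u → conjugate (value χ u) C.≈ value (inverseCharacter κ χ) u
  conjugate-value χ u = inverse-unique (⟦ χ ⟧ u) (unitary (value χ u) d zᵈ⁺¹≈1)
    where
    d = proj₁ (unit-order u)
    open SetoidReasoning C.setoid
    zᵈ⁺¹≈1 : suc d ⊗ᶜ value χ u C.≈ C.1#
    zᵈ⁺¹≈1 = begin
      suc d ⊗ᶜ value χ u    ≈⟨ multiple-homo κˣ.monoid C.*-monoid (value-homo χ) (suc d) u ⟨
      value χ (suc d ⊗ u)   ≈⟨ value-cong χ {suc d ⊗ u} {κˣ.ε} (proj₂ (unit-order u)) ⟩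
      value χ κˣ.ε          ≈⟨ IsMonoidHomomorphism.ε-homo (value-homo χ) ⟩
      C.1#                  ∎
    inverse-unique : ∀ (z : ℂˣ.Carrier) {w} → proj₁ z C.* w C.≈ C.1# → w C.≈ proj₁ (z ℂˣ.⁻¹)
    inverse-unique (z , z⁻¹ , z⁻¹z , zz⁻¹) {w} zw = begin
      w                 ≈⟨ C.*-identityˡ w ⟨
      C.1# C.* w        ≈⟨ C.*-congʳ z⁻¹z ⟨
      (z⁻¹ C.* z) C.* w ≈⟨ C.*-assoc z⁻¹ z w ⟩
      z⁻¹ C.* (z C.* w) ≈⟨ C.*-congˡ zw ⟩
      z⁻¹ C.* C.1#      ≈⟨ C.*-identityʳ z⁻¹ ⟩
      z⁻¹               ∎

  -- χ(g/h), extended by zero.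
  quotient : Character → Carrier → Carrier → ℂ
  quotient χ g h with g ≟ 0# | h ≟ 0#
  ... | no g≉0 | no h≉0 = value χ ((g , invertible g g≉0) κˣ.∙ (h , invertible h h≉0) κˣ.⁻¹)
  ... | _      | _      = 0ᶜ

  evaluate≡quotient : ∀ {n} χ G H (x : Vec Carrier n) →
    evaluate κ χ (G / H) x ≡ quotient χ (Polynomial.eval commutativeRing n G x) (Polynomial.eval commutativeRing n H x)
  evaluate≡quotient {n} χ G H x
    with Polynomial.eval commutativeRing n G x ≟ 0# | Polynomial.eval commutativeRing n H x ≟ 0#
  ... | no _  | no _  = ≡.refl
  ... | no _  | yes _ = ≡.refl
  ... | yes _ | no _  = ≡.refl
  ... | yes _ | yes _ = ≡.refl

  unit-nonzero : ∀ (u : κˣ.Carrier) → ¬ proj₁ u ≈ 0#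
  unit-nonzero (u , u⁻¹ , _ , uu⁻¹) u≈0 = 0≉1 (trans (sym (zeroˡ u⁻¹)) (trans (*-congʳ (sym u≈0)) uu⁻¹))

  -- Any unit representing `g` is accepted, not only the one built from `invertible`, so a product
  -- of representatives represents the product.
  ZeroOrUnit : Carrier → Set _
  ZeroOrUnit g = g ≈ 0# ⊎ ∃ λ (u : κˣ.Carrier) → proj₁ u ≈ g

  zero-or-unit : ∀ g → ZeroOrUnit g
  zero-or-unit g with g ≟ 0#
  ... | yes g≈0 = inj₁ g≈0
  ... | no  g≉0 = inj₂ ((g , invertible g g≉0) , κ.refl)

  quotient-zero : ∀ χ {g h} → g ≈ 0# ⊎ h ≈ 0# → quotient χ g h C.≈ 0ᶜ
  quotient-zero χ {g} {h} g≈0∨h≈0 with g ≟ 0# | h ≟ 0# | g≈0∨h≈0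
  ... | no g≉0 | no _   | inj₁ g≈0 = contradiction g≈0 g≉0
  ... | no _   | no h≉0 | inj₂ h≈0 = contradiction h≈0 h≉0
  ... | no _   | yes _  | _        = C.refl
  ... | yes _  | no _   | _        = C.refl
  ... | yes _  | yes _  | _        = C.refl

  -- The inverses chosen by `quotient` do not matter: equality of units sees only the underlying
  -- elements, and both inversion and χ respect it.
  quotient-unit : ∀ χ {g h} u v → proj₁ u ≈ g → proj₁ v ≈ h → quotient χ g h C.≈ value χ (u κˣ.∙ v κˣ.⁻¹)
  quotient-unit χ {g} {h} u v u≈g v≈h with g ≟ 0# | h ≟ 0#
  ... | yes g≈0 | _       = contradiction (trans u≈g g≈0) (unit-nonzero u)
  ... | no _    | yes h≈0 = contradiction (trans v≈h h≈0) (unit-nonzero v)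
  ... | no g≉0  | no h≉0  = value-cong χ {g′ κˣ.∙ h′ κˣ.⁻¹} {u κˣ.∙ v κˣ.⁻¹}
    (κˣ.∙-cong {g′} {u} {h′ κˣ.⁻¹} {v κˣ.⁻¹} (sym u≈g) (κˣ.⁻¹-cong {h′} {v} (sym v≈h)))
    where
    g′ = g , invertible g g≉0
    h′ = h , invertible h h≉0

  quotient-cong : ∀ χ {g g′ h h′} → g ≈ g′ → h ≈ h′ → quotient χ g h C.≈ quotient χ g′ h′
  quotient-cong χ {g} {g′} {h} {h′} g≈g′ h≈h′ = by-cases (zero-or-unit g) (zero-or-unit h)
    where
    by-cases : ZeroOrUnit g → ZeroOrUnit h → quotient χ g h C.≈ quotient χ g′ h′
    by-cases (inj₁ g≈0) _ = C.trans (quotient-zero χ (inj₁ g≈0))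
      (C.sym (quotient-zero χ (inj₁ (trans (sym g≈g′) g≈0))))
    by-cases (inj₂ _) (inj₁ h≈0) = C.trans (quotient-zero χ (inj₂ h≈0))
      (C.sym (quotient-zero χ (inj₂ (trans (sym h≈h′) h≈0))))
    by-cases (inj₂ (u , u≈g)) (inj₂ (v , v≈h)) = C.trans (quotient-unit χ u v u≈g v≈h)
      (C.sym (quotient-unit χ u v (trans u≈g g≈g′) (trans v≈h h≈h′)))

  quotient-1 : ∀ χ → quotient χ 1# 1# C.≈ C.1#
  quotient-1 χ = C.trans (quotient-unit χ κˣ.ε κˣ.ε κ.refl κ.refl)
    (C.trans (value-cong χ {κˣ.ε κˣ.∙ κˣ.ε κˣ.⁻¹} {κˣ.ε} (κˣ.inverseʳ κˣ.ε))
      (IsMonoidHomomorphism.ε-homo (value-homo χ)))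

  -- A vanishing factor makes both sides zero. Otherwise all four entries are units, and closure of
  -- units under products replaces any argument about zero divisors.
  quotient-* : ∀ χ g g′ h h′ →
    quotient χ (g * g′) (h * h′) C.≈ quotient χ g h C.* quotient χ g′ h′
  quotient-* χ g g′ h h′ =
    by-cases (zero-or-unit g) (zero-or-unit h) (zero-or-unit g′) (zero-or-unit h′)
    where
    zeroˡ-* : ∀ {a b} → a ≈ 0# → a * b ≈ 0#
    zeroˡ-* a≈0 = trans (*-congʳ a≈0) (zeroˡ _)
    zeroʳ-* : ∀ {a b} → b ≈ 0# → a * b ≈ 0#
    zeroʳ-* b≈0 = trans (*-congˡ b≈0) (zeroʳ _)
    vanishˡ : g * g′ ≈ 0# ⊎ h * h′ ≈ 0# → g ≈ 0# ⊎ h ≈ 0# →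
              quotient χ (g * g′) (h * h′) C.≈ quotient χ g h C.* quotient χ g′ h′
    vanishˡ p q = C.trans (quotient-zero χ p)
      (C.sym (C.trans (C.*-congʳ (quotient-zero χ q)) (C.zeroˡ _)))
    vanishʳ : g * g′ ≈ 0# ⊎ h * h′ ≈ 0# → g′ ≈ 0# ⊎ h′ ≈ 0# →
              quotient χ (g * g′) (h * h′) C.≈ quotient χ g h C.* quotient χ g′ h′
    vanishʳ p q = C.trans (quotient-zero χ p)
      (C.sym (C.trans (C.*-congˡ (quotient-zero χ q)) (C.zeroʳ _)))
    by-cases : ZeroOrUnit g → ZeroOrUnit h → ZeroOrUnit g′ → ZeroOrUnit h′ →
               quotient χ (g * g′) (h * h′) C.≈ quotient χ g h C.* quotient χ g′ h′
    by-cases (inj₁ g≈0) _ _ _ = vanishˡ (inj₁ (zeroˡ-* g≈0)) (inj₁ g≈0)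
    by-cases (inj₂ _) (inj₁ h≈0) _ _ = vanishˡ (inj₂ (zeroˡ-* h≈0)) (inj₂ h≈0)
    by-cases (inj₂ _) (inj₂ _) (inj₁ g′≈0) _ = vanishʳ (inj₁ (zeroʳ-* g′≈0)) (inj₁ g′≈0)
    by-cases (inj₂ _) (inj₂ _) (inj₂ _) (inj₁ h′≈0) = vanishʳ (inj₂ (zeroʳ-* h′≈0)) (inj₂ h′≈0)
    by-cases (inj₂ (u , u≈g)) (inj₂ (v , v≈h)) (inj₂ (u′ , u′≈g′)) (inj₂ (v′ , v′≈h′)) = begin
      quotient χ (g * g′) (h * h′)
        ≈⟨ quotient-unit χ (u κˣ.∙ u′) (v κˣ.∙ v′) (*-cong u≈g u′≈g′) (*-cong v≈h v′≈h′) ⟩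
      value χ ((u κˣ.∙ u′) κˣ.∙ (v κˣ.∙ v′) κˣ.⁻¹)
        ≈⟨ value-cong χ {(u κˣ.∙ u′) κˣ.∙ (v κˣ.∙ v′) κˣ.⁻¹} {(u κˣ.∙ v κˣ.⁻¹) κˣ.∙ (u′ κˣ.∙ v′ κˣ.⁻¹)}
             (interchange (proj₁ u) (proj₁ u′) (proj₁ (v κˣ.⁻¹)) (proj₁ (v′ κˣ.⁻¹))) ⟩
      value χ ((u κˣ.∙ v κˣ.⁻¹) κˣ.∙ (u′ κˣ.∙ v′ κˣ.⁻¹))
        ≈⟨ IsMonoidHomomorphism.homo (value-homo χ) (u κˣ.∙ v κˣ.⁻¹) (u′ κˣ.∙ v′ κˣ.⁻¹) ⟩
      value χ (u κˣ.∙ v κˣ.⁻¹) C.* value χ (u′ κˣ.∙ v′ κˣ.⁻¹)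
        ≈⟨ C.*-cong (quotient-unit χ u v u≈g v≈h) (quotient-unit χ u′ v′ u′≈g′ v′≈h′) ⟨
      quotient χ g h C.* quotient χ g′ h′ ∎
      where
      open SetoidReasoning C.setoid
      open Algebra.Properties.CommutativeSemigroup *-commutativeSemigroup using (interchange)

  module _ (χ : Character) (g h : Carrier) where
    private
      χ⁻¹ = inverseCharacter κ χ

    quotient-swap : quotient χ h g C.≈ quotient χ⁻¹ g h
    quotient-swap with zero-or-unit g | zero-or-unit h
    ... | inj₁ g≈0 | _ =
      C.trans (quotient-zero χ (inj₂ g≈0)) (C.sym (quotient-zero χ⁻¹ (inj₁ g≈0)))
    ... | inj₂ _ | inj₁ h≈0 =
      C.trans (quotient-zero χ (inj₁ h≈0)) (C.sym (quotient-zero χ⁻¹ (inj₂ h≈0)))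
    ... | inj₂ (u , u≈g) | inj₂ (v , v≈h) = begin
      quotient χ h g                   ≈⟨ quotient-unit χ v u v≈h u≈g ⟩
      -- Inverses of units are formed componentwise, so the inverse of u v⁻¹ already is u⁻¹ v and
      -- only commutativity remains.
      value χ (v κˣ.∙ u κˣ.⁻¹)         ≈⟨ value-cong χ {v κˣ.∙ u κˣ.⁻¹} {(u κˣ.∙ v κˣ.⁻¹) κˣ.⁻¹} (*-comm _ _) ⟩
      value χ ((u κˣ.∙ v κˣ.⁻¹) κˣ.⁻¹) ≈⟨ value-inverse χ (u κˣ.∙ v κˣ.⁻¹) ⟩
      value χ⁻¹ (u κˣ.∙ v κˣ.⁻¹)       ≈⟨ quotient-unit χ⁻¹ u v u≈g v≈h ⟨
      quotient χ⁻¹ g h                 ∎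
      where open SetoidReasoning C.setoid

    conjugate-quotient : conjugate (quotient χ g h) C.≈ quotient χ⁻¹ g h
    conjugate-quotient with g ≟ 0# | h ≟ 0#
    ... | no g≉0 | no h≉0 = conjugate-value χ ((g , invertible g g≉0) κˣ.∙ (h , invertible h h≉0) κˣ.⁻¹)
    ... | no _   | yes _  = IsMonoidHomomorphism.ε-homo conjugate-+-homo
    ... | yes _  | no _   = IsMonoidHomomorphism.ε-homo conjugate-+-homo
    ... | yes _  | yes _  = IsMonoidHomomorphism.ε-homo conjugate-+-homo

  module _ {n : ℕ} where
    open Polynomial commutativeRing using (eval; multiply; translate; constant)
    open Evaluation commutativeRing
    open Fraction

    evaluate-quotient : ∀ χ f (x : Vec Carrier n) {g h} →
      eval n (numerator f) x ≈ g → eval n (denominator f) x ≈ h → evaluate κ χ f x C.≈ quotient χ g h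
    evaluate-quotient χ (G / H) x G≈g H≈h =
      C.trans (C.reflexive (evaluate≡quotient χ G H x)) (quotient-cong χ G≈g H≈h)

    evaluate-· : ∀ χ f f′ (x : Vec Carrier n) →
      evaluate κ χ (_·_ κ f f′) x C.≈ evaluate κ χ f x C.* evaluate κ χ f′ x
    evaluate-· χ f@(G / H) f′@(G′ / H′) x = C.trans
      (evaluate-quotient χ (_·_ κ f f′) x (eval-multiply n G G′ x) (eval-multiply n H H′ x))
      (C.trans (quotient-* χ (eval n G x) (eval n G′ x) (eval n H x) (eval n H′ x))
        (C.sym (C.*-cong (evaluate-quotient χ f x κ.refl κ.refl) (evaluate-quotient χ f′ x κ.refl κ.refl))))

    evaluate-product : ∀ χ {k} (f : Fin k → Fraction κ n) x →
      evaluate κ χ (productFraction κ f) x C.≈ product (λ j → evaluate κ χ (f j) x)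
    evaluate-product χ {zero}  f x = C.trans
      (evaluate-quotient χ (oneFraction κ) x (eval-constant n 1# x) (eval-constant n 1# x)) (quotient-1 χ)
    evaluate-product χ {suc k} f x =
      C.trans (evaluate-· χ (f Fin.zero) (productFraction κ (f ∘ Fin.suc)) x)
        (C.*-congˡ (evaluate-product χ (f ∘ Fin.suc) x))

    evaluate-translate : ∀ χ m f x →
      evaluate κ χ (translateFraction κ m f) x C.≈ evaluate κ χ f (_⊕_ κ m x)
    evaluate-translate χ m f@(G / H) x = C.trans
      (evaluate-quotient χ (translateFraction κ m f) x (eval-translate n m G x) (eval-translate n m H x))
      (C.sym (evaluate-quotient χ f (_⊕_ κ m x) κ.refl κ.refl))

    -- The convention for zeros is symmetric in numerator and denominator, so exchanging them only
    -- inverts the character.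
    evaluate-reciprocal : ∀ χ f (x : Vec Carrier n) →
      evaluate κ χ (reciprocal κ f) x C.≈ evaluate κ (inverseCharacter κ χ) f x
    evaluate-reciprocal χ f@(G / H) x = C.trans
      (evaluate-quotient χ (reciprocal κ f) x κ.refl κ.refl)
      (C.trans (quotient-swap χ (eval n G x) (eval n H x))
        (C.sym (evaluate-quotient (inverseCharacter κ χ) f x κ.refl κ.refl)))

    conjugate-evaluate : ∀ χ f (x : Vec Carrier n) →
      conjugate (evaluate κ χ f x) C.≈ evaluate κ (inverseCharacter κ χ) f x
    conjugate-evaluate χ f x = C.trans (conjugate-cong (evaluate-quotient χ f x κ.refl κ.refl))
      (C.trans (conjugate-quotient χ (eval n (numerator f) x) (eval n (denominator f) x))
        (C.sym (evaluate-quotient (inverseCharacter κ χ) f x κ.refl κ.refl)))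

-- The moment identity and the two forms of `T`.

open import Data.Nat using (_+_; _*_)

module _ where
  open Algebra.Properties.Semiring.Exp R.semiring using (^-assocʳ; ^-congˡ)
  open Algebra.Properties.CommutativeMonoid.Mult C.*-commutativeMonoid
    using (×-congʳ; ×-distrib-+) renaming (_×_ to _⊗_)
  open Algebra.Properties.CommutativeMonoid.Sum C.*-commutativeMonoid using (sum-replicate)
  open SetoidReasoning C.setoid

  -- Powers are written as products of equal factors, the shape that `product-of-sums₂` expands. `w`
  -- stands for the conjugate so that the sum with inverse characters can be put in its place.
  ∣z∣²ˢ≈product : ∀ z {w} → conjugate z C.≈ w → ∀ s →
    fromReal (∣ z ∣ ^ᴿ (2 * s)) C.≈ product {s} (λ _ → z) C.* product {s} (λ _ → w)
  ∣z∣²ˢ≈product z {w} z̄≈w s = begin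
    fromReal (∣ z ∣ ^ᴿ (2 * s))
      ≈⟨ fromReal-cong (R.trans (R.sym (^-assocʳ ∣ z ∣ 2 s)) (^-congˡ s (∣z∣²≈norm² z))) ⟩
    fromReal (norm² z ^ᴿ s)
      ≈⟨ multiple-homo R.*-monoid C.*-monoid fromReal-*-homo s (norm² z) ⟩
    s ⊗ fromReal (norm² z)
      ≈⟨ ×-congʳ s (C.trans (C.sym (z*conjugate-z z)) (C.*-congˡ z̄≈w)) ⟩
    s ⊗ (z C.* w)
      ≈⟨ ×-distrib-+ z w s ⟩
    s ⊗ z C.* s ⊗ w
      ≈⟨ C.*-cong (sum-replicate s) (sum-replicate s) ⟨
    product {s} (λ _ → z) C.* product {s} (λ _ → w) ∎
    where
    fromReal-cong : ∀ {x y} → x R.≈ y → fromReal x C.≈ fromReal y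
    fromReal-cong = IsMonoidHomomorphism.⟦⟧-cong fromReal-*-homo

module Moments {c ℓ} (κ : FiniteField c ℓ) (n r : ℕ)
  (F : Fin r → RationalFunction κ n) (χ : Fin r → MultiplicativeCharacter κ) (s : ℕ) where
  open FiniteField κ using (Carrier)
  open RationalFunction using (fraction)
  open Characters κ
  open Summation κ ℂ-commutativeRing
  open Algebra.Properties.CommutativeMonoid.Sum C.*-commutativeMonoid
    using (∑-comm; ∑-distrib-+; sum-cong-≋)
  open SetoidReasoning C.setoid

  Point = Vec Carrier n

  ∑ : (Point → ℂ) → ℂ
  ∑ = sumPoints κ ℂ-commutativeRing n

  ∑ᵗ : ∀ k → (Vec Point k → ℂ) → ℂ
  ∑ᵗ = sumPointTuples κ ℂ-commutativeRing n

  term term⁻¹ : Fin r → Point → Point → ℂ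
  term   i m x = evaluate κ (χ i) (fraction (F i)) (_⊕_ κ m x)
  term⁻¹ i m x = evaluate κ (inverseCharacter κ (χ i)) (fraction (F i)) (_⊕_ κ m x)

  conjugate-S : ∀ x → conjugate (S κ F χ x) C.≈ ∑ (λ m → product (λ i → term⁻¹ i m (lookup x i)))
  conjugate-S x = C.trans
    (Transport.points-homo κ ℂ-commutativeRing ℂ-commutativeRing conjugate-+-homo n
      (λ m → product (λ i → term i m (lookup x i))))
    (IsLinear.cong (points-linear n) λ m → C.trans
      (sum-homo C.*-commutativeMonoid C.*-commutativeMonoid conjugate-*-homo (λ i → term i m (lookup x i)))
      (sum-cong-≋ λ i → conjugate-evaluate (χ i) (fraction (F i)) (_⊕_ κ m (lookup x i))))

  T-terms : Fin r → Vec Point (s + s) → Point → ℂ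
  T-terms i m x = product (λ (j : Fin s) → term i (lookup m (j ↑ˡ s)) x)
             C.* product (λ (j : Fin s) → term⁻¹ i (lookup m (s ↑ʳ j)) x)

  S-terms : Vec Point r → Vec Point (s + s) → ℂ
  S-terms x m = product (λ (j : Fin s) → product (λ i → term i (lookup m (j ↑ˡ s)) (lookup x i)))
           C.* product (λ (j : Fin s) → product (λ i → term⁻¹ i (lookup m (s ↑ʳ j)) (lookup x i)))

  ∣S∣²ˢ : ∀ x → fromReal (∣ S κ F χ x ∣ ^ᴿ (2 * s)) C.≈ ∑ᵗ (s + s) (S-terms x)
  ∣S∣²ˢ x = C.trans (∣z∣²ˢ≈product (S κ F χ x) (conjugate-S x) s)
    (product-of-sums₂ (points-linear n) s s
      (λ _ m → product (λ i → term i m (lookup x i))) (λ _ m → product (λ i → term⁻¹ i m (lookup x i))))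

  -- Once the products over j and i are exchanged and the two halves merged, the factor at i depends
  -- on `x` only through its entry i, so the variables separate.
  S-terms≈T-terms : ∀ x m → S-terms x m C.≈ product (λ i → T-terms i m (lookup x i))
  S-terms≈T-terms x m = C.trans
    (C.*-cong (∑-comm (λ (j : Fin s) i → term i (lookup m (j ↑ˡ s)) (lookup x i)))
              (∑-comm (λ (j : Fin s) i → term⁻¹ i (lookup m (s ↑ʳ j)) (lookup x i))))
    (C.sym (∑-distrib-+ (λ i → product (λ (j : Fin s) → term i (lookup m (j ↑ˡ s)) (lookup x i)))
                        (λ i → product (λ (j : Fin s) → term⁻¹ i (lookup m (s ↑ʳ j)) (lookup x i)))))

  moment : fromReal (sumPointTuples κ ℝ-commutativeRing n r (λ x → ∣ S κ F χ x ∣ ^ᴿ (2 * s)))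
    C.≈ ∑ᵗ (s + s) (λ m → product (λ i → T κ (F i) (χ i) s m))
  moment = begin
    fromReal (sumPointTuples κ ℝ-commutativeRing n r (λ x → ∣ S κ F χ x ∣ ^ᴿ (2 * s)))
      ≈⟨ Transport.pointTuples-homo κ ℝ-commutativeRing ℂ-commutativeRing fromReal-+-homo n r
           (λ x → ∣ S κ F χ x ∣ ^ᴿ (2 * s)) ⟩
    ∑ᵗ r (λ x → fromReal (∣ S κ F χ x ∣ ^ᴿ (2 * s)))
      ≈⟨ IsLinear.cong (pointTuples-linear n r) ∣S∣²ˢ ⟩
    ∑ᵗ r (λ x → ∑ᵗ (s + s) (S-terms x))
      ≈⟨ linear-commute (pointTuples-linear n r) n (s + s) S-terms ⟩
    ∑ᵗ (s + s) (λ m → ∑ᵗ r (λ x → S-terms x m))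
      ≈⟨ IsLinear.cong (pointTuples-linear n (s + s)) (λ m →
           C.trans (IsLinear.cong (pointTuples-linear n r) (λ x → S-terms≈T-terms x m))
             -- Used from right to left: the sum over `r`-tuples of separated factors is the product
             -- of `r` sums over points, each of which unfolds from `T`.
             (C.sym (product-of-sums (points-linear n) r (λ i → T-terms i m)))) ⟩
    ∑ᵗ (s + s) (λ m → product (λ i → T κ (F i) (χ i) s m)) ∎

  T≈shiftedProduct : ∀ i m →
    T κ (F i) (χ i) s m C.≈ ∑ (λ x → evaluate κ (χ i) (shiftedProduct κ (F i) s m) x)
  T≈shiftedProduct i m = IsLinear.cong (points-linear n) λ x → C.sym (begin
    evaluate κ (χ i) (shiftedProduct κ (F i) s m) x
      ≈⟨ evaluate-· (χ i) (productFraction κ numerators) (productFraction κ denominators) x ⟩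
    evaluate κ (χ i) (productFraction κ numerators) x C.* evaluate κ (χ i) (productFraction κ denominators) x
      ≈⟨ C.*-cong (evaluate-product (χ i) numerators x) (evaluate-product (χ i) denominators x) ⟩
    product (λ j → evaluate κ (χ i) (numerators j) x) C.* product (λ j → evaluate κ (χ i) (denominators j) x)
      ≈⟨ C.*-cong
           (sum-cong-≋ λ j → evaluate-translate (χ i) (lookup m (j ↑ˡ s)) (fraction (F i)) x)
           (sum-cong-≋ λ j → C.trans
             (evaluate-reciprocal (χ i) (translateFraction κ (lookup m (s ↑ʳ j)) (fraction (F i))) x)
             (evaluate-translate (inverseCharacter κ (χ i)) (lookup m (s ↑ʳ j)) (fraction (F i)) x)) ⟩
    T-terms i m x ∎)
    where
    numerators denominators : Fin s → Fraction κ n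
    numerators   j = translateFraction κ (lookup m (j ↑ˡ s)) (fraction (F i))
    denominators j = reciprocal κ (translateFraction κ (lookup m (s ↑ʳ j)) (fraction (F i)))

proposition1p2 : {c ℓ : Level} (κ : FiniteField c ℓ) (n r : ℕ) .{{_ : NonZero n}} .{{_ : NonZero r}}
    (F : Fin r → RationalFunction κ n) (χ : Fin r → MultiplicativeCharacter κ) (s : ℕ) →
    (fromReal (sumPointTuples κ ℝ-commutativeRing n r (λ x → ∣ S κ F χ x ∣ ^ᴿ (2 * s)))
    ≈ᶜ sumPointTuples κ ℂ-commutativeRing n (s + s) (λ m → product (λ i → T κ (F i) (χ i) s m)))
    × ((i : Fin r) (m : Vec (Vec (FiniteField.Carrier κ) n) (s + s)) →
    T κ (F i) (χ i) s m
    ≈ᶜ sumPoints κ ℂ-commutativeRing n (λ x → evaluate κ (χ i) (shiftedProduct κ (F i) s m) x))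
proposition1p2 κ n r F χ s = moment , T≈shiftedProduct
  where open Moments κ n r F χ s
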